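{- For every integer $n\ge 1$, $AP_n$ is similar to the disjoint union of two copies of $AD_{n-1}$, one copy of $S_{2n}$, and one copy of $S'_{2n}$.
   Context: The adjacency matrix of a weighted directed graph has rows and columns indexed by the vertices, its $(u,v)$-entry being the weight of the directed edge from $u$ to $v$ if there is one, and $0$ otherwise (a loop of weight $c$ at $u$ contributes the diagonal entry $c$). Undirected graphs are viewed as directed by replacing each edge by a pair of anti-parallel arcs of the same weight; unweighted edges have weight $1$, and for parallel edges the adjacency matrix entry is the number of parallel edges. Two graphs are called similar if their adjacency matrices are similar matrices. The Aztec diamond $AD_n$ is the subgraph of the grid $(\mathbb{Z}+1/2)^2$ (nearest-neighbor edges) induced by the vertices $(x,y)$ with $|x|+|y|\le n$ ($AD_0$ is empty). The Aztec pillowcase $AP_n$ is the graph obtained from two copies of $AD_n$ by identifying corresponding vertices on (the boundary of) their convex hull, i.e. the vertices with $|x|+|y|=n$; all edges of both copies are kept, which leads to four pairs of parallel edges. $P_m^{(q)}$ denotes the path on $m$ vertices with all edges weighted $q$. $S_m$ is the directed graph on $m$ vertices obtained from $P_{m-1}^{(2)}$ by regarding each edge as a pair of anti-parallel arcs of weight $2$, and including an extra vertex $v$, an arc of weight $2$ directed from $v$ to the rightmost (last) vertex of $P_{m-1}^{(2)}$, and a loop at $v$ of weight $4$. $S'_m$ is constructed analogously from $P_{m-1}^{(-2)}$: each edge becomes a pair of anti-parallel arcs of weight $-2$, the arc from the new vertex $v$ to the last vertex of the path has weight $-2$, and the loop at $v$ has weight $-4$. -}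

module Defs where

import Algebra.Properties.CommutativeMonoid.Sum as Sum
open import Data.Bool.Base using (Bool; true; false; if_then_else_; _∧_)
open import Data.Fin.Base using (Fin; toℕ)
import Data.Fin.Properties as Fin
open import Data.Integer.Base as ℤ using (ℤ; +_; ∣_∣)
open import Data.Maybe.Base using (Maybe; just; nothing)
open import Data.Nat.Base as ℕ using (ℕ; suc; ∣_-_∣; pred)
import Data.Nat.Properties as ℕ
open import Data.Product.Base using (Σ-syntax; ∃-syntax; _×_; _,_)
open import Data.Rational.Base using (ℚ; 0ℚ; 1ℚ; _+_; _*_; -_; _/_)
open import Data.Rational.Properties using (+-0-commutativeMonoid)
open import Data.Sum.Base using (_⊎_; inj₁; inj₂)
open import Function.Base using (_on_)
open import Function.Bundles using (_↔_; Inverse)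
open import Relation.Binary.PropositionalEquality using (_≡_)
open import Relation.Nullary.Decidable using (does)

open Sum +-0-commutativeMonoid using (sum)

Matrix : ℕ → Set
Matrix n = Fin n → Fin n → ℚ

infix  4 _≋_
infixl 7 _⊗_

_≋_ : ∀ {n} → Matrix n → Matrix n → Set
A ≋ B = ∀ i j → A i j ≡ B i j

_⊗_ : ∀ {n} → Matrix n → Matrix n → Matrix n
(A ⊗ B) i j = sum (λ k → A i k * B k j)

identity : ∀ {n} → Matrix n
identity i j = if does (i Fin.≟ j) then 1ℚ else 0ℚ

SimilarMatrices : ∀ {n} → Matrix n → Matrix n → Set
SimilarMatrices {n} A B =
  Σ[ P ∈ Matrix n ] Σ[ P⁻¹ ∈ Matrix n ]
    (P ⊗ P⁻¹ ≋ identity) × (P⁻¹ ⊗ P ≋ identity) × (A ≋ P ⊗ B ⊗ P⁻¹)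

-- `weight u v` is the total weight of the arcs from u to v, and 0 if there
-- are none: parallel arcs add up, and an undirected edge contributes to both
-- `weight u v` and `weight v u`.

record Graph : Set₁ where
  field
    Vertex : Set
    weight : Vertex → Vertex → ℚ

open Graph public

adjacency : ∀ {n} (G : Graph) → Fin n ↔ Vertex G → Matrix n
adjacency G e i j = weight G (Inverse.to e i) (Inverse.to e j)

-- Different enumerations of the same graph give adjacency matrices conjugate
-- by a permutation matrix, so it does not matter which ones are taken.

Similar : Graph → Graph → Set
Similar G H =
  ∃[ n ] Σ[ e ∈ Fin n ↔ Vertex G ] Σ[ f ∈ Fin n ↔ Vertex H ]
    SimilarMatrices (adjacency G e) (adjacency H f)

infixr 5 _⊍_

_⊍_ : Graph → Graph → Graph
(G ⊍ H) .Vertex                   = Vertex G ⊎ Vertex H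
(G ⊍ H) .weight (inj₁ u) (inj₁ v) = weight G u v
(G ⊍ H) .weight (inj₁ _) (inj₂ _) = 0ℚ
(G ⊍ H) .weight (inj₂ _) (inj₁ _) = 0ℚ
(G ⊍ H) .weight (inj₂ u) (inj₂ v) = weight H u v

-- The pair (a , b) of integers stands for the point (a + 1/2 , b + 1/2).

HalfPoint : Set
HalfPoint = ℤ × ℤ

-- Twice |x| + |y|, where x = a + 1/2 and y = b + 1/2.

twiceNorm : HalfPoint → ℕ
twiceNorm (a , b) = ∣ + 2 ℤ.* a ℤ.+ + 1 ∣ ℕ.+ ∣ + 2 ℤ.* b ℤ.+ + 1 ∣

gridAdjacent : HalfPoint → HalfPoint → Bool
gridAdjacent (a , b) (c , d) =
  does ((∣ a ℤ.- c ∣ ℕ.+ ∣ b ℤ.- d ∣) ℕ.≟ 1)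

gridWeight : HalfPoint → HalfPoint → ℚ
gridWeight p q = if gridAdjacent p q then 1ℚ else 0ℚ

record ADVertex (n : ℕ) : Set where
  constructor vertex
  field
    point  : HalfPoint
    inside : twiceNorm point ℕ.≤ 2 ℕ.* n

open ADVertex public

AD : ℕ → Graph
AD n .Vertex = ADVertex n
AD n .weight = gridWeight on point

-- The two copies of AD n are labelled by Bool.  A vertex with |x| + |y| < n
-- occurs once for each copy, a vertex with |x| + |y| = n only once.

data APVertex (n : ℕ) : Set where
  interior : Bool → (p : ADVertex n) → twiceNorm (point p) ℕ.< 2 ℕ.* n →
             APVertex n
  boundary : (p : ADVertex n) → twiceNorm (point p) ≡ 2 ℕ.* n → APVertex n

underlying : ∀ {n} → APVertex n → ADVertex n
underlying (interior _ p _) = p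
underlying (boundary p _)   = p

inCopy : ∀ {n} → Bool → APVertex n → Bool
inCopy true  (interior true  _ _) = true
inCopy true  (interior false _ _) = false
inCopy false (interior true  _ _) = false
inCopy false (interior false _ _) = true
inCopy _     (boundary _ _)       = true

copyWeight : ∀ {n} → Bool → APVertex n → APVertex n → ℚ
copyWeight {n} s u v =
  if inCopy s u ∧ inCopy s v
  then weight (AD n) (underlying u) (underlying v)
  else 0ℚ

-- The edges of both copies are kept, so an edge joining two boundary vertices
-- is counted twice.

AP : ℕ → Graph
AP n .Vertex     = APVertex n
AP n .weight u v = copyWeight true u v + copyWeight false u v

Path : ℚ → ℕ → Graph
Path q m .Vertex     = Fin m
Path q m .weight i j = if does (∣ toℕ i - toℕ j ∣ ℕ.≟ 1) then q else 0ℚ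

-- The graph on m ≥ 1 vertices obtained from `Path q (m - 1)` by adding a
-- vertex, `nothing`, with an arc of weight q to the last vertex of the path
-- and a loop of weight c.

LoopedPath : (q c : ℚ) → ℕ → Graph
LoopedPath q c m .Vertex                   = Maybe (Fin (pred m))
LoopedPath q c m .weight (just i) (just j) = weight (Path q (pred m)) i j
LoopedPath q c m .weight (just _) nothing  = 0ℚ
LoopedPath q c m .weight nothing  (just j) =
  if does (suc (toℕ j) ℕ.≟ pred m) then q else 0ℚ
LoopedPath q c m .weight nothing  nothing  = c

S : ℕ → Graph
S = LoopedPath (+ 2 / 1) (+ 4 / 1)

S′ : ℕ → Graph
S′ = LoopedPath (- (+ 2 / 1)) (- (+ 4 / 1))

{-# OPTIONS --safe #-}
module Submission where

-- Weights act on functions by (A f)(u) = Σ w(u,v) f(v), and a similarity is a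
-- bijective linear map commuting with these operators.  Functions on AP n
-- split into those antisymmetric and those symmetric under the exchange of the
-- two copies of AD n.  The antisymmetric ones vanish on the boundary and give
-- AD (n - 1); the symmetric ones are functions on AD n, with the operator
-- doubled on the boundary.
--
-- In the coordinates s = x + y + n and t = x - y + n, the vertices of AD n are
-- the pairs in {0, …, 2n} of opposite parity, and a step changes both s and t
-- by ±1.  So the symmetric part is (the opposite-parity half of) A ⊗ A, where A
-- is the path on 0, …, 2n reflected at its end points.  The difference
-- (D f)(s) = f(s+1) - f(s-1) carries A to the path B on 1, …, 2n - 1 with zero
-- boundary values; completed by the sums of f over the even and over the odd
-- points (end points counted half), it is bijective, and the two sums are
-- interchanged by A up to a factor 2.  The four parts of the tensor product are
-- AD (n - 1), two copies of 2B, and a 2 × 2 block with eigenvalues ±4.  Finally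
-- S is similar to 2B plus a loop of weight 4 because (1, 2, …, 2n) is a left
-- eigenvector, and S′ is treated in the same way after alternating signs.

open import Defs
open import Algebra.Bundles using (CommutativeRing)
import Algebra.Properties.AbelianGroup as AbelianGroupProperties
import Algebra.Properties.Semiring.Sum as SemiringSum
open import Data.Bool.Base using (Bool; true; false; not; if_then_else_)
open import Data.Empty using (⊥-elim)
open import Data.Fin.Base using (Fin; zero; suc; toℕ; inject₁; fromℕ<; _↑ˡ_; _↑ʳ_)
import Data.Fin.Properties as Fin
open import Data.Integer.Base as ℤ using (ℤ; -[1+_]; ∣_∣)
import Data.Integer.Properties as ℤ
import Data.Integer.Solver as ℤ-Solver
open import Data.Maybe.Base using (Maybe; just; nothing)
open import Data.Nat.Base as ℕ using (ℕ; zero; suc; _≤_; _∸_; _⊔_; z≤n; s≤s) renaming (∣_-_∣ to ∣_⊝_∣)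
import Data.Nat.Properties as ℕ
open import Data.Product.Base using (∃-syntax; _×_; _,_; proj₁; proj₂)
open import Data.Product.Function.NonDependent.Propositional using (_×-↔_)
open import Data.Rational.Base as ℚ using (ℚ; 0ℚ; 1ℚ; ½; _+_; _*_; -_; _-_; _/_; 1/_)
import Data.Rational.Properties as ℚ
open import Data.Rational.Solver using (module +-*-Solver)
open import Data.Sum.Base using (_⊎_; inj₁; inj₂; [_,_]′)
open import Data.Sum.Function.Propositional using (_⊎-↔_)
open import Data.Unit.Base using (⊤; tt)
open import Function.Base using (_∘_; const)
open import Function.Bundles using (_↔_; Inverse; mk↔ₛ′)
open import Function.Properties.Inverse using (↔-refl; ↔-sym; ↔-trans)
open import Relation.Binary.PropositionalEquality
  using (_≡_; _≢_; _≗_; refl; sym; trans; cong; cong₂; subst; module ≡-Reasoning)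
open import Relation.Nullary using (contradiction)
open import Relation.Nullary.Decidable using (Dec; does; yes; no; dec-true; dec-false)

open +-*-Solver using (solve; _:+_; _:*_; _:-_; :-_; con; _:=_)
open Inverse using (to; from; strictlyInverseˡ; strictlyInverseʳ)
open SemiringSum (CommutativeRing.semiring ℚ.+-*-commutativeRing)
  using (sum; sum-cong-≗; ∑-distrib-+; sum-permute; *-distribˡ-sum)
open ≡-Reasoning

private
  module ZS = ℤ-Solver.+-*-Solver
  module ℤ-Group = AbelianGroupProperties ℤ.+-0-abelianGroup

-- Conjugating matrices are never multiplied out: each step is a linear map given by its kernel and
-- its preimages, and only `≈⇒Similar` passes to coordinates.
--
-- Since only positions of opposite parity occur, the path operator is cut into its two rectangular
-- blocks, even to odd and odd to even, and `Board` is the graph built from them. The reduction of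
-- the folded diamond then rests on two intertwining relations in one dimension, one for each block.
--
-- Differencing kills the constants on each parity class, so one coordinate per class has to be
-- restored. Any functional that is nonzero on constants would give a bijection, but in general only
-- a block triangular operator. The half weights at the end points make the operator block diagonal.
-- The factor 2 counts the neighbours of a point, mirror images included; one restored coordinate
-- beside a path gives 2B, two of them give 4 = 2 · 2.
--
-- Splitting S is the same device: the coordinate at the extra vertex is replaced by a left
-- eigenfunctional with a nonzero entry there, and the loop weight is exactly its eigenvalue.

2ℚ 4ℚ : ℚ
2ℚ = ℤ.+ 2 / 1
4ℚ = ℤ.+ 4 / 1

-- Linear forms and summation over finite types

Fun : Set → Set
Fun X = X → ℚ

-- Functions are compared pointwise throughout, so respecting `_≗_` has to be part of the structure.
record LinearForm {X : Set} (ℓ : Fun X → ℚ) : Set where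
  field
    ℓ-cong      : ∀ {f g} → f ≗ g → ℓ f ≡ ℓ g
    additive    : ∀ f g → ℓ (λ x → f x + g x) ≡ ℓ f + ℓ g
    homogeneous : ∀ c f → ℓ (λ x → c * f x) ≡ c * ℓ f

  ℓ-zero : ∀ {f} → (∀ x → f x ≡ 0ℚ) → ℓ f ≡ 0ℚ
  ℓ-zero {f} f≡0 = begin
    ℓ f                 ≡⟨ ℓ-cong (λ x → trans (f≡0 x) (sym (ℚ.*-zeroˡ (f x)))) ⟩
    ℓ (λ x → 0ℚ * f x)  ≡⟨ homogeneous 0ℚ f ⟩
    0ℚ * ℓ f            ≡⟨ ℚ.*-zeroˡ (ℓ f) ⟩
    0ℚ                  ∎

  ℓ-sum : ∀ {n} (h : Fin n → Fun X) → ℓ (λ x → sum (λ k → h k x)) ≡ sum (ℓ ∘ h)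
  ℓ-sum {zero}  h = ℓ-zero (λ _ → refl)
  ℓ-sum {suc n} h = trans (additive (h zero) _) (cong (ℓ (h zero) +_) (ℓ-sum (h ∘ suc)))

  ℓ-diff : ∀ f g → ℓ (λ x → f x - g x) ≡ ℓ f - ℓ g
  ℓ-diff f g = begin
    ℓ (λ x → f x - g x)             ≡⟨ ℓ-cong (λ x → cong (f x +_) (neg (g x))) ⟩
    ℓ (λ x → f x + (- 1ℚ) * g x)    ≡⟨ additive f _ ⟩
    ℓ f + ℓ (λ x → (- 1ℚ) * g x)    ≡⟨ cong (ℓ f +_) (homogeneous (- 1ℚ) g) ⟩
    ℓ f + (- 1ℚ) * ℓ g              ≡⟨ cong (ℓ f +_) (sym (neg (ℓ g))) ⟩
    ℓ f - ℓ g                       ∎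
    where
    neg : ∀ q → - q ≡ (- 1ℚ) * q
    neg = solve 1 (λ q → :- q := con (- 1ℚ) :* q) refl

open LinearForm

Linear : {X Y : Set} → (Fun X → Fun Y) → Set
Linear T = ∀ y → LinearForm (λ f → T f y)

eval-linear : ∀ {X} (x : X) → LinearForm (λ f → f x)
eval-linear x = record
  { ℓ-cong = λ f≗g → f≗g x ; additive = λ _ _ → refl ; homogeneous = λ _ _ → refl }

+-linear : ∀ {X} {ℓ ℓ′ : Fun X → ℚ} →
  LinearForm ℓ → LinearForm ℓ′ → LinearForm (λ f → ℓ f + ℓ′ f)
+-linear {ℓ = ℓ} {ℓ′} L L′ = record
  { ℓ-cong = λ f≗g → cong₂ _+_ (ℓ-cong L f≗g) (ℓ-cong L′ f≗g)
  ; additive = λ f g → trans (cong₂ _+_ (additive L f g) (additive L′ f g))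
      (solve 4 (λ a b c d → (a :+ b) :+ (c :+ d) := (a :+ c) :+ (b :+ d)) refl
        (ℓ f) (ℓ g) (ℓ′ f) (ℓ′ g))
  ; homogeneous = λ c f → trans (cong₂ _+_ (homogeneous L c f) (homogeneous L′ c f))
      (sym (ℚ.*-distribˡ-+ c (ℓ f) (ℓ′ f)))
  }

*-linear : ∀ {X} {ℓ : Fun X → ℚ} c → LinearForm ℓ → LinearForm (λ f → c * ℓ f)
*-linear {ℓ = ℓ} c L = record
  { ℓ-cong = λ f≗g → cong (c *_) (ℓ-cong L f≗g)
  ; additive = λ f g → trans (cong (c *_) (additive L f g)) (ℚ.*-distribˡ-+ c (ℓ f) (ℓ g))
  ; homogeneous = λ d f → trans (cong (c *_) (homogeneous L d f))
      (solve 3 (λ c d x → c :* (d :* x) := d :* (c :* x)) refl c d (ℓ f))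
  }

-‿linear : ∀ {X} {ℓ : Fun X → ℚ} → LinearForm ℓ → LinearForm (λ f → - ℓ f)
-‿linear {ℓ = ℓ} L = record
  { ℓ-cong = λ f≗g → cong -_ (ℓ-cong L f≗g)
  ; additive = λ f g → trans (cong -_ (additive L f g)) (ℚ.neg-distrib-+ (ℓ f) (ℓ g))
  ; homogeneous = λ d f → trans (cong -_ (homogeneous L d f)) (ℚ.neg-distribʳ-* d (ℓ f))
  }

∘-linear : ∀ {X Y} {ℓ : Fun Y → ℚ} {T : Fun X → Fun Y} →
  LinearForm ℓ → Linear T → LinearForm (ℓ ∘ T)
∘-linear {ℓ = ℓ} {T} L LT = record
  { ℓ-cong = λ f≗g → ℓ-cong L (λ y → ℓ-cong (LT y) f≗g)
  ; additive = λ f g → trans (ℓ-cong L (λ y → additive (LT y) f g)) (additive L (T f) (T g))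
  ; homogeneous = λ c f → trans (ℓ-cong L (λ y → homogeneous (LT y) c f)) (homogeneous L c (T f))
  }

sum-linear : ∀ {n} → LinearForm {Fin n} sum
sum-linear = record
  { ℓ-cong = sum-cong-≗
  ; additive = ∑-distrib-+
  ; homogeneous = λ c f → sym (*-distribˡ-sum c f)
  }

restrict-linear : ∀ {X Y : Set} (h : Y → X) → Linear (λ (f : Fun X) → f ∘ h)
restrict-linear h y = eval-linear (h y)

record Finite (X : Set) : Set where
  field
    {size}      : ℕ
    enumeration : Fin size ↔ X

open Finite

∑ : ∀ {X} → Finite X → Fun X → ℚ
∑ F f = sum (f ∘ to (enumeration F))

∑-linear : ∀ {X} (F : Finite X) → LinearForm (∑ F)
∑-linear F = ∘-linear sum-linear (restrict-linear (to (enumeration F)))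

-- Two enumerations differ by a permutation of the indices, which leaves a sum unchanged. For `β`
-- the identity this makes `∑` independent of the enumeration.
∑-reindex : ∀ {X Y} (F : Finite X) (F′ : Finite Y) (β : X ↔ Y) (f : Fun Y) →
  ∑ F (f ∘ to β) ≡ ∑ F′ f
∑-reindex F F′ β f = begin
  sum (f ∘ to β ∘ to e)      ≡⟨ sum-cong-≗ (λ i → cong f (strictlyInverseˡ e′ (to β (to e i)))) ⟨
  sum (λ i → (f ∘ to e′) (to π i))  ≡⟨ sum-permute (f ∘ to e′) π ⟨
  sum (f ∘ to e′)            ∎
  where
  e  = enumeration F
  e′ = enumeration F′
  π  = ↔-trans e (↔-trans β (↔-sym e′))

image-finite : ∀ {X Y : Set} → X ↔ Y → Finite X → Finite Y
image-finite β F = record { enumeration = ↔-trans (enumeration F) β }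

Fin-finite : ∀ n → Finite (Fin n)
Fin-finite n = record { enumeration = ↔-refl }

⊎-finite : ∀ {X Y} → Finite X → Finite Y → Finite (X ⊎ Y)
⊎-finite F F′ = record { enumeration = ↔-trans Fin.+↔⊎ (enumeration F ⊎-↔ enumeration F′) }

×-finite : ∀ {X Y} → Finite X → Finite Y → Finite (X × Y)
×-finite F F′ = record { enumeration = ↔-trans Fin.*↔× (enumeration F ×-↔ enumeration F′) }

⊤⊎↔Maybe : ∀ {X : Set} → (⊤ ⊎ X) ↔ Maybe X
⊤⊎↔Maybe = mk↔ₛ′ (λ { (inj₁ _) → nothing ; (inj₂ x) → just x })
                  (λ { nothing → inj₁ tt ; (just x) → inj₂ x })
                  (λ { nothing → refl ; (just _) → refl })
                  (λ { (inj₁ _) → refl ; (inj₂ _) → refl })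

⊤-finite : Finite ⊤
⊤-finite = record { enumeration = Fin.1↔⊤ }

Maybe-finite : ∀ {X} → Finite X → Finite (Maybe X)
Maybe-finite F = image-finite ⊤⊎↔Maybe (⊎-finite ⊤-finite F)

sum-+ : ∀ m {n} (f : Fun (Fin (m ℕ.+ n))) →
  sum f ≡ sum (f ∘ (_↑ˡ n)) + sum (f ∘ (m ↑ʳ_))
sum-+ zero    f = sym (ℚ.+-identityˡ (sum f))
sum-+ (suc m) f = trans (cong (f zero +_) (sum-+ m (f ∘ suc)))
                        (sym (ℚ.+-assoc (f zero) _ _))

∑-⊎ : ∀ {X Y} (F : Finite X) (F′ : Finite Y) (f : Fun (X ⊎ Y)) →
  ∑ (⊎-finite F F′) f ≡ ∑ F (f ∘ inj₁) + ∑ F′ (f ∘ inj₂)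
∑-⊎ F F′ f = trans (sum-+ (size F) _) (cong₂ _+_
  (sum-cong-≗ (λ i → cong (f ∘ to (enumeration F ⊎-↔ enumeration F′)) (Fin.splitAt-↑ˡ (size F) i (size F′))))
  (sum-cong-≗ (λ i → cong (f ∘ to (enumeration F ⊎-↔ enumeration F′)) (Fin.splitAt-↑ʳ (size F) (size F′) i))))

sum-× : ∀ m n (f : Fun (Fin m × Fin n)) →
  sum (f ∘ to (Fin.*↔× {m} {n})) ≡ sum (λ i → sum (λ j → f (i , j)))
sum-× zero    n f = refl
sum-× (suc m) n f = trans (sum-+ n _) (cong₂ _+_
  (sum-cong-≗ λ i → cong f (Fin.remQuot-combine {suc m} {n} zero i))
  (trans (sum-cong-≗ λ i → cong f (lemma i)) (sum-× m n (λ (i , j) → f (suc i , j)))))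
  where
  lemma : ∀ i → to (Fin.*↔× {suc m} {n}) (n ↑ʳ i)
              ≡ (suc (proj₁ (to (Fin.*↔× {m} {n}) i)) , proj₂ (to (Fin.*↔× {m} {n}) i))
  lemma i rewrite Fin.splitAt-↑ʳ n (m ℕ.* n) i = refl

∑-× : ∀ {X Y} (F : Finite X) (F′ : Finite Y) (f : Fun (X × Y)) →
  ∑ (×-finite F F′) f ≡ ∑ F (λ x → ∑ F′ (λ y → f (x , y)))
∑-× F F′ f = sum-× (size F) (size F′) (f ∘ to (enumeration F ×-↔ enumeration F′))

∑-⊤ : ∀ (f : Fun ⊤) → ∑ ⊤-finite f ≡ f tt
∑-⊤ f = ℚ.+-identityʳ (f tt)

∑-Maybe : ∀ {X} (F : Finite X) (f : Fun (Maybe X)) →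
  ∑ (Maybe-finite F) f ≡ f nothing + ∑ F (f ∘ just)
∑-Maybe F f = trans (∑-⊎ ⊤-finite F (f ∘ to ⊤⊎↔Maybe)) (cong (_+ ∑ F (f ∘ just)) (∑-⊤ (const (f nothing))))

sum-identity : ∀ {n} (i : Fin n) (f : Fun (Fin n)) → sum (λ k → f k * identity k i) ≡ f i
sum-identity zero f = trans
  (cong₂ _+_ (ℚ.*-identityʳ (f zero)) (ℓ-zero sum-linear (λ k → ℚ.*-zeroʳ (f (suc k)))))
  (ℚ.+-identityʳ (f zero))
sum-identity (suc i) f = trans
  (cong₂ _+_ (ℚ.*-zeroʳ (f zero)) (sum-identity i (f ∘ suc)))
  (ℚ.+-identityˡ (f (suc i)))

-- Indicator functions are indexed by positions in the enumeration, so that equality is only ever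
-- decided in `Fin`.
δ : ∀ {X} (F : Finite X) → Fin (size F) → Fun X
δ F k x = identity k (from (enumeration F) x)

module _ {X} {ℓ : Fun X → ℚ} (L : LinearForm ℓ) where

  -- Every function is the combination of the indicators `δ F k` with its own values as
  -- coefficients. The numbers `ℓ (δ F k)` are the matrix row that represents `ℓ`.
  linear-expand : ∀ (F : Finite X) f → ℓ f ≡ sum (λ k → ℓ (δ F k) * f (to (enumeration F) k))
  linear-expand F f = begin
    ℓ f                                         ≡⟨ ℓ-cong L f≗ ⟨
    ℓ (λ x → sum (λ k → f (to e k) * δ F k x))  ≡⟨ ℓ-sum L (λ k x → f (to e k) * δ F k x) ⟩
    sum (λ k → ℓ (λ x → f (to e k) * δ F k x))  ≡⟨ sum-cong-≗ (λ k → homogeneous L (f (to e k)) (δ F k)) ⟩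
    sum (λ k → f (to e k) * ℓ (δ F k))          ≡⟨ sum-cong-≗ (λ k → ℚ.*-comm (f (to e k)) (ℓ (δ F k))) ⟩
    sum (λ k → ℓ (δ F k) * f (to e k))          ∎
    where
    e = enumeration F
    f≗ : (λ x → sum (λ k → f (to e k) * δ F k x)) ≗ f
    f≗ x = trans (sum-identity (from e x) (f ∘ to e)) (cong f (strictlyInverseˡ e x))

  -- A Fubini rule. Expanding `ℓ` as a finite sum lets `ℓ′` pass through it by linearity, so
  -- finiteness is required of one variable only.
  linear-exchange : ∀ {Y} {ℓ′ : Fun Y → ℚ} → Finite X → LinearForm ℓ′ → ∀ (f : X → Y → ℚ) →
    ℓ (λ x → ℓ′ (f x)) ≡ ℓ′ (λ y → ℓ (λ x → f x y))
  linear-exchange {ℓ′ = ℓ′} F L′ f = begin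
    ℓ (λ x → ℓ′ (f x))                                ≡⟨ linear-expand F (ℓ′ ∘ f) ⟩
    sum (λ k → ℓ (δ F k) * ℓ′ (f (to e k)))           ≡⟨ sum-cong-≗ (λ k → homogeneous L′ (ℓ (δ F k)) (f (to e k))) ⟨
    sum (λ k → ℓ′ (λ y → ℓ (δ F k) * f (to e k) y))   ≡⟨ ℓ-sum L′ (λ k y → ℓ (δ F k) * f (to e k) y) ⟨
    ℓ′ (λ y → sum (λ k → ℓ (δ F k) * f (to e k) y))   ≡⟨ ℓ-cong L′ (λ y → linear-expand F (λ x → f x y)) ⟨
    ℓ′ (λ y → ℓ (λ x → f x y))                        ∎
    where e = enumeration F

apply : ∀ {X Y} → Finite Y → (X → Y → ℚ) → Fun Y → Fun X
apply F w f x = ∑ F (λ y → w x y * f y)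

apply-linear : ∀ {X Y} (F : Finite Y) (w : X → Y → ℚ) → Linear (apply F w)
apply-linear F w x = ∘-linear (∑-linear F) (λ y → *-linear (w x y) (eval-linear y))

operator : (G : Graph) → Finite (Vertex G) → Fun (Vertex G) → Fun (Vertex G)
operator G F = apply F (weight G)

operator-irrelevant : ∀ G (F F′ : Finite (Vertex G)) f → operator G F f ≗ operator G F′ f
operator-irrelevant G F F′ f u = ∑-reindex F F′ ↔-refl (λ v → weight G u v * f v)

-- A trivial kernel and a chosen preimage of each function suffice: linearity of `inverse` follows
-- from `cancel` and need not be checked on the formula for the preimages.
record LinearIso {X Y : Set} (T : Fun X → Fun Y) : Set where
  field
    linear     : Linear T
    injective  : ∀ {f} → (∀ y → T f y ≡ 0ℚ) → ∀ x → f x ≡ 0ℚ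
    surjective : ∀ g → ∃[ f ] T f ≗ g

  cancel : ∀ {f g} → T f ≗ T g → f ≗ g
  cancel {f} {g} Tf≗Tg x = begin
    f x              ≡⟨ solve 2 (λ a b → a := (a :- b) :+ b) refl (f x) (g x) ⟩
    (f x - g x) + g x ≡⟨ cong (_+ g x) (injective (λ y → trans (ℓ-diff (linear y) f g)
                          (trans (cong (_- T g y) (Tf≗Tg y)) (ℚ.+-inverseʳ (T g y)))) x) ⟩
    0ℚ + g x         ≡⟨ ℚ.+-identityˡ (g x) ⟩
    g x              ∎

  inverse : Fun Y → Fun X
  inverse g = proj₁ (surjective g)

  inverseˡ : ∀ g → T (inverse g) ≗ g
  inverseˡ g = proj₂ (surjective g)

  inverseʳ : ∀ f → inverse (T f) ≗ f
  inverseʳ f = cancel (inverseˡ (T f))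

  inverse-linear : Linear inverse
  inverse-linear x = record
    { ℓ-cong = λ {f} {g} f≗g → cancel (λ y → trans (inverseˡ f y) (trans (f≗g y) (sym (inverseˡ g y)))) x
    ; additive = λ f g → cancel (λ y → trans (inverseˡ _ y) (sym (trans
        (additive (linear y) (inverse f) (inverse g)) (cong₂ _+_ (inverseˡ f y) (inverseˡ g y))))) x
    ; homogeneous = λ c f → cancel (λ y → trans (inverseˡ _ y) (sym (trans
        (homogeneous (linear y) c (inverse f)) (cong (c *_) (inverseˡ f y))))) x
    }

∘-linearIso : ∀ {X Y Z} {T : Fun X → Fun Y} {U : Fun Y → Fun Z} →
  LinearIso U → LinearIso T → LinearIso (U ∘ T)
∘-linearIso {T = T} {U} IU IT = record
  { linear = λ z → ∘-linear (linear IU z) (linear IT)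
  ; injective = λ p → injective IT (injective IU p)
  ; surjective = λ g → inverse IT (inverse IU g) ,
      λ z → trans (ℓ-cong (linear IU z) (inverseˡ IT (inverse IU g))) (inverseˡ IU g z)
  }
  where open LinearIso

inverse-linearIso : ∀ {X Y} {T : Fun X → Fun Y} (I : LinearIso T) → LinearIso (LinearIso.inverse I)
inverse-linearIso {T = T} I = record
  { linear = inverse-linear
  ; injective = λ {f} p y → trans (sym (inverseˡ f y)) (ℓ-zero (linear y) p)
  ; surjective = λ g → T g , inverseʳ g
  }
  where open LinearIso I

-- Similarity as isomorphism of operators

infix 4 _≈_

-- `bijection` is unrelated to `map`. It only provides enumerations of equal length for the two
-- graphs and so replaces an argument about dimension.
record _≈_ (G H : Graph) : Set where
  field
    finiteˡ   : Finite (Vertex G)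
    finiteʳ   : Finite (Vertex H)
    bijection : Vertex G ↔ Vertex H
    map       : Fun (Vertex G) → Fun (Vertex H)
    isIso     : LinearIso map
    commutes  : ∀ f → operator H finiteʳ (map f) ≗ map (operator G finiteˡ f)

-- The columns of the conjugating matrix are the preimages of the indicator
-- functions.

≈⇒Similar : ∀ {G H} → G ≈ H → Similar G H
≈⇒Similar {G} {H} G≈H =
  size F , e , f , P , P⁻¹ , PP⁻¹ , P⁻¹P , conj
  where
  open _≈_ G≈H
  open LinearIso isIso
  F  = finiteˡ
  -- Enumerating `H` through the bijection gives both matrices literally the same index type.
  F′ = image-finite bijection F
  e  = enumeration F
  f  = enumeration F′

  P P⁻¹ : Matrix (size F)
  P i j   = inverse (δ F′ j) (to e i)
  P⁻¹ i j = map (δ F j) (to f i)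

  δ-to : ∀ {X} (F : Finite X) i j → δ F j (to (enumeration F) i) ≡ identity i j
  δ-to F i j rewrite strictlyInverseʳ (enumeration F) i = identity-sym j i
    where
    identity-sym : ∀ {n} (i j : Fin n) → identity i j ≡ identity j i
    identity-sym zero    zero    = refl
    identity-sym zero    (suc j) = refl
    identity-sym (suc i) zero    = refl
    identity-sym (suc i) (suc j) = identity-sym i j

  PP⁻¹ : P ⊗ P⁻¹ ≋ identity
  PP⁻¹ i j = begin
    sum (λ k → P i k * P⁻¹ k j)      ≡⟨ linear-expand (inverse-linear (to e i)) F′ (map (δ F j)) ⟨
    inverse (map (δ F j)) (to e i)   ≡⟨ inverseʳ (δ F j) (to e i) ⟩
    δ F j (to e i)                   ≡⟨ δ-to F i j ⟩
    identity i j                     ∎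

  P⁻¹P : P⁻¹ ⊗ P ≋ identity
  P⁻¹P i j = begin
    sum (λ k → P⁻¹ i k * P k j)      ≡⟨ linear-expand (linear (to f i)) F (inverse (δ F′ j)) ⟨
    map (inverse (δ F′ j)) (to f i)  ≡⟨ inverseˡ (δ F′ j) (to f i) ⟩
    δ F′ j (to f i)                  ≡⟨ δ-to F′ i j ⟩
    identity i j                     ∎

  operator-δ : ∀ G (F : Finite (Vertex G)) k u → operator G F (δ F k) u ≡ weight G u (to (enumeration F) k)
  operator-δ G F k u = trans
    (sum-cong-≗ λ i → cong (weight G u (to (enumeration F) i) *_) (δ-to F i k))
    (sum-identity k (weight G u ∘ to (enumeration F)))

  A = adjacency G e
  B = adjacency H f

  PB : ∀ i k → (P ⊗ B) i k ≡ inverse (operator H F′ (δ F′ k)) (to e i)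
  PB i k = begin
    sum (λ l → P i l * B l k)                       ≡⟨ linear-expand (inverse-linear (to e i)) F′ (λ y → weight H y (to f k)) ⟨
    inverse (λ y → weight H y (to f k)) (to e i)    ≡⟨ ℓ-cong (inverse-linear (to e i)) (operator-δ H F′ k) ⟨
    inverse (operator H F′ (δ F′ k)) (to e i)       ∎

  conj : A ≋ P ⊗ B ⊗ P⁻¹
  conj i j = sym (begin
    sum (λ k → (P ⊗ B) i k * P⁻¹ k j)               ≡⟨ sum-cong-≗ (λ k → cong (_* P⁻¹ k j) (PB i k)) ⟩
    sum (λ k → inverse (operator H F′ (δ F′ k)) (to e i) * map (δ F j) (to f k))
      ≡⟨ linear-expand (∘-linear (inverse-linear (to e i)) (apply-linear F′ (weight H))) F′ (map (δ F j)) ⟨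
    inverse (operator H F′ (map (δ F j))) (to e i)
      -- The matrix of `H` sums over `F′`, while `commutes` speaks of `finiteʳ`.
      ≡⟨ ℓ-cong (inverse-linear (to e i)) (λ y → trans (operator-irrelevant H F′ finiteʳ (map (δ F j)) y) (commutes (δ F j) y)) ⟩
    inverse (map (operator G F (δ F j))) (to e i)   ≡⟨ inverseʳ (operator G F (δ F j)) (to e i) ⟩
    operator G F (δ F j) (to e i)                   ≡⟨ operator-δ G F j (to e i) ⟩
    A i j                                           ∎)

≈-sym : ∀ {G H} → G ≈ H → H ≈ G
≈-sym {G} {H} G≈H = record
  { finiteˡ = finiteʳ
  ; finiteʳ = finiteˡ
  ; bijection = ↔-sym bijection
  ; map = inverse
  ; isIso = inverse-linearIso isIso
  ; commutes = λ g → cancel λ y → begin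
      map (operator G finiteˡ (inverse g)) y   ≡⟨ commutes (inverse g) y ⟨
      operator H finiteʳ (map (inverse g)) y   ≡⟨ ℓ-cong (apply-linear finiteʳ (weight H) y) (inverseˡ g) ⟩
      operator H finiteʳ g y                   ≡⟨ inverseˡ _ y ⟨
      map (inverse (operator H finiteʳ g)) y   ∎
  }
  where
  open _≈_ G≈H
  open LinearIso isIso

≈-trans : ∀ {G H K} → G ≈ H → H ≈ K → G ≈ K
≈-trans {G} {H} {K} G≈H H≈K = record
  { finiteˡ = GH.finiteˡ
  ; finiteʳ = HK.finiteʳ
  ; bijection = ↔-trans GH.bijection HK.bijection
  ; map = HK.map ∘ GH.map
  ; isIso = ∘-linearIso HK.isIso GH.isIso
  ; commutes = λ f z → trans (HK.commutes (GH.map f) z)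
      (ℓ-cong (LinearIso.linear HK.isIso z) λ y →
        trans (operator-irrelevant H HK.finiteˡ GH.finiteʳ (GH.map f) y) (GH.commutes f y))
  }
  where
  module GH = _≈_ G≈H
  module HK = _≈_ H≈K

relabel : ∀ {G H} → Finite (Vertex G) → (β : Vertex G ↔ Vertex H) →
  (∀ u v → weight G u v ≡ weight H (to β u) (to β v)) → G ≈ H
-- Composition with `to β` pulls functions on `H` back to `G`, so the similarity is built in this
-- direction and then reversed.
relabel {G} {H} F β w≡ = ≈-sym record
  { finiteˡ = F′
  ; finiteʳ = F
  ; bijection = ↔-sym β
  ; map = _∘ to β
  ; isIso = record
    { linear = restrict-linear (to β)
    ; injective = λ {f} p v → trans (cong f (sym (strictlyInverseˡ β v))) (p (from β v))
    ; surjective = λ g → g ∘ from β , λ u → cong g (strictlyInverseʳ β u)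
    }
  ; commutes = λ f u → trans
      (ℓ-cong (∑-linear F) (λ v → cong (_* f (to β v)) (w≡ u v)))
      (∑-reindex F F′ β (λ v → weight H (to β u) v * f v))
  }
  where F′ = image-finite β F

≈-refl : ∀ {G} → Finite (Vertex G) → G ≈ G
≈-refl F = relabel F ↔-refl (λ _ _ → refl)

module _ (G H : Graph) (F : Finite (Vertex G)) (F′ : Finite (Vertex H)) where

  operator-⊍ˡ : ∀ f u → operator (G ⊍ H) (⊎-finite F F′) f (inj₁ u) ≡ operator G F (f ∘ inj₁) u
  operator-⊍ˡ f u = begin
    operator (G ⊍ H) (⊎-finite F F′) f (inj₁ u)
      ≡⟨ ∑-⊎ F F′ (λ v → weight (G ⊍ H) (inj₁ u) v * f v) ⟩
    operator G F (f ∘ inj₁) u + ∑ F′ (λ v → 0ℚ * f (inj₂ v))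
      ≡⟨ cong (operator G F (f ∘ inj₁) u +_) (ℓ-zero (∑-linear F′) (λ v → ℚ.*-zeroˡ (f (inj₂ v)))) ⟩
    operator G F (f ∘ inj₁) u + 0ℚ
      ≡⟨ ℚ.+-identityʳ _ ⟩
    operator G F (f ∘ inj₁) u ∎

  operator-⊍ʳ : ∀ f u → operator (G ⊍ H) (⊎-finite F F′) f (inj₂ u) ≡ operator H F′ (f ∘ inj₂) u
  operator-⊍ʳ f u = begin
    operator (G ⊍ H) (⊎-finite F F′) f (inj₂ u)
      ≡⟨ ∑-⊎ F F′ (λ v → weight (G ⊍ H) (inj₂ u) v * f v) ⟩
    ∑ F (λ v → 0ℚ * f (inj₁ v)) + operator H F′ (f ∘ inj₂) u
      ≡⟨ cong (_+ operator H F′ (f ∘ inj₂) u) (ℓ-zero (∑-linear F) (λ v → ℚ.*-zeroˡ (f (inj₁ v)))) ⟩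
    0ℚ + operator H F′ (f ∘ inj₂) u
      ≡⟨ ℚ.+-identityˡ _ ⟩
    operator H F′ (f ∘ inj₂) u ∎

⊍-cong : ∀ {G G′ H H′} → G ≈ G′ → H ≈ H′ → G ⊍ H ≈ G′ ⊍ H′
⊍-cong {G} {G′} {H} {H′} p q = record
  { finiteˡ = ⊎-finite P.finiteˡ Q.finiteˡ
  ; finiteʳ = ⊎-finite P.finiteʳ Q.finiteʳ
  ; bijection = P.bijection ⊎-↔ Q.bijection
  ; map = T
  ; isIso = record
    { linear = λ { (inj₁ y) → ∘-linear (PI.linear y) (restrict-linear inj₁)
                 ; (inj₂ y) → ∘-linear (QI.linear y) (restrict-linear inj₂) }
    ; injective = λ r → λ { (inj₁ x) → PI.injective (r ∘ inj₁) x
                          ; (inj₂ x) → QI.injective (r ∘ inj₂) x }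
    ; surjective = λ g → [ PI.inverse (g ∘ inj₁) , QI.inverse (g ∘ inj₂) ]′ ,
        λ { (inj₁ y) → PI.inverseˡ (g ∘ inj₁) y ; (inj₂ y) → QI.inverseˡ (g ∘ inj₂) y }
    }
  ; commutes = λ f → λ
    { (inj₁ y) → trans (operator-⊍ˡ G′ H′ P.finiteʳ Q.finiteʳ (T f) y) (trans (P.commutes (f ∘ inj₁) y)
        (ℓ-cong (PI.linear y) λ u → sym (operator-⊍ˡ G H P.finiteˡ Q.finiteˡ f u)))
    ; (inj₂ y) → trans (operator-⊍ʳ G′ H′ P.finiteʳ Q.finiteʳ (T f) y) (trans (Q.commutes (f ∘ inj₂) y)
        (ℓ-cong (QI.linear y) λ u → sym (operator-⊍ʳ G H P.finiteˡ Q.finiteˡ f u)))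
    }
  }
  where
  module P = _≈_ p
  module Q = _≈_ q
  module PI = LinearIso P.isIso
  module QI = LinearIso Q.isIso
  T : Fun (Vertex (G ⊍ H)) → Fun (Vertex (G′ ⊍ H′))
  T f (inj₁ y) = P.map (f ∘ inj₁) y
  T f (inj₂ y) = Q.map (f ∘ inj₂) y

-- Tensor products of bipartite graphs

tensor : ∀ {I I′ J J′ : Set} → (Fun I → Fun I′) → (Fun J → Fun J′) →
  (I → J → ℚ) → I′ → J′ → ℚ
tensor U V f i′ j′ = U (λ i → V (f i) j′) i′

module _ {I J I′ J′ : Set} {U : Fun I → Fun I′} {V : Fun J → Fun J′}
         (IU : LinearIso U) (IV : LinearIso V) where

  private
    module U = LinearIso IU
    module V = LinearIso IV

  tensor-injective : ∀ f → (∀ i′ j′ → tensor U V f i′ j′ ≡ 0ℚ) → ∀ i j → f i j ≡ 0ℚ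
  tensor-injective f p i = V.injective (λ j′ → U.injective (λ i′ → p i′ j′) i)

  tensor-surjective : ∀ (g : I′ → J′ → ℚ) → ∃[ f ] (∀ i′ j′ → tensor U V f i′ j′ ≡ g i′ j′)
  tensor-surjective g =
    (λ i → V.inverse (λ j′ → U.inverse (λ i′ → g i′ j′) i)) ,
    (λ i′ j′ → trans (ℓ-cong (U.linear i′) (λ i → V.inverseˡ _ j′)) (U.inverseˡ _ i′))

-- Operators on different variables commute by `linear-exchange`. Moving `Y′` inside `W` brings it
-- next to `Z`, where the second relation applies; the first then applies to the outer variable, and
-- a second exchange restores the order.
tensor-commutes : ∀ {I I′ J J′ K K′ L L′ : Set}
  {U : Fun I → Fun I′} {V : Fun J → Fun J′} {W : Fun K → Fun K′} {Z : Fun L → Fun L′}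
  (FJ : Finite J) (FK : Finite K) (FK′ : Finite K′) (FL : Finite L) (FL′ : Finite L′) →
  (∀ i′ → LinearForm (λ f → U f i′)) → Linear V → Linear W → Linear Z →
  (x : I → K → ℚ) (x′ : I′ → K′ → ℚ) (y : J → L → ℚ) (y′ : J′ → L′ → ℚ) →
  (∀ f → apply FK′ x′ (W f) ≗ U (apply FK x f)) →
  (∀ f → apply FL′ y′ (Z f) ≗ V (apply FL y f)) →
  ∀ f i′ j′ → tensor (apply FK′ x′) (apply FL′ y′) (tensor W Z f) i′ j′
            ≡ tensor U V (tensor (apply FK x) (apply FL y) f) i′ j′
tensor-commutes {U = U} {V} {W} {Z} FJ FK FK′ FL FL′ LU LV LW LZ x x′ y y′ xW yZ f i′ j′ = begin
  X′ (λ k′ → Y′ (λ l′ → W (λ k → Z (f k) l′) k′) j′) i′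
    ≡⟨ ℓ-cong (apply-linear FK′ x′ i′) (λ k′ →
         linear-exchange (apply-linear FL′ y′ j′) FL′ (LW k′) (λ l′ k → Z (f k) l′)) ⟩
  X′ (λ k′ → W (λ k → Y′ (Z (f k)) j′) k′) i′
    ≡⟨ ℓ-cong (apply-linear FK′ x′ i′) (λ k′ → ℓ-cong (LW k′) (λ k → yZ (f k) j′)) ⟩
  X′ (W (λ k → V (Y (f k)) j′)) i′
    ≡⟨ xW (λ k → V (Y (f k)) j′) i′ ⟩
  U (X (λ k → V (Y (f k)) j′)) i′
    ≡⟨ ℓ-cong (LU i′) (λ i → linear-exchange (LV j′) FJ (apply-linear FK x i) (λ j k → Y (f k) j)) ⟨
  U (λ i → V (λ j → X (λ k → Y (f k) j) i) j′) i′ ∎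
  where
  X = apply FK x ; X′ = apply FK′ x′ ; Y = apply FL y ; Y′ = apply FL′ y′

-- The two classes of vertices are the two colour classes of a chessboard.

Board : {I J : Set} → (I → J → ℚ) → (J → I → ℚ) → Graph
Board {I} {J} x y .Vertex = (I × J) ⊎ (J × I)
Board x y .weight (inj₁ (i , j)) (inj₂ (k , l)) = x i k * y j l
Board x y .weight (inj₂ (k , l)) (inj₁ (i , j)) = y k i * x l j
Board x y .weight (inj₁ _)       (inj₁ _)       = 0ℚ
Board x y .weight (inj₂ _)       (inj₂ _)       = 0ℚ

Board-finite : ∀ {I J : Set} → Finite I → Finite J → Finite ((I × J) ⊎ (J × I))
Board-finite FI FJ = ⊎-finite (×-finite FI FJ) (×-finite FJ FI)

∑-tensor : ∀ {I J} (FI : Finite I) (FJ : Finite J) (a : Fun I) (b : Fun J) (f : I × J → ℚ) →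
  ∑ (×-finite FI FJ) (λ (i , j) → a i * b j * f (i , j)) ≡ ∑ FI (λ i → a i * ∑ FJ (λ j → b j * f (i , j)))
∑-tensor FI FJ a b f = begin
  ∑ (×-finite FI FJ) (λ (i , j) → a i * b j * f (i , j))   ≡⟨ ∑-× FI FJ (λ (i , j) → a i * b j * f (i , j)) ⟩
  ∑ FI (λ i → ∑ FJ (λ j → a i * b j * f (i , j)))
    ≡⟨ ℓ-cong (∑-linear FI) (λ i → trans
         (ℓ-cong (∑-linear FJ) (λ j → ℚ.*-assoc (a i) (b j) (f (i , j))))
         (homogeneous (∑-linear FJ) (a i) (λ j → b j * f (i , j)))) ⟩
  ∑ FI (λ i → a i * ∑ FJ (λ j → b j * f (i , j)))          ∎

module _ {I J : Set} (FI : Finite I) (FJ : Finite J) (x : I → J → ℚ) (y : J → I → ℚ)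
         (f : Fun (Vertex (Board x y))) where

  private
    F = Board-finite FI FJ

  operator-Board₁ : ∀ i j → operator (Board x y) F f (inj₁ (i , j))
    ≡ tensor (apply FJ x) (apply FI y) (λ k l → f (inj₂ (k , l))) i j
  operator-Board₁ i j = begin
    operator (Board x y) F f (inj₁ (i , j))
      ≡⟨ ∑-⊎ (×-finite FI FJ) (×-finite FJ FI) (λ v → weight (Board x y) (inj₁ (i , j)) v * f v) ⟩
    ∑ (×-finite FI FJ) (λ v → 0ℚ * f (inj₁ v)) + s
      ≡⟨ cong (_+ s) (ℓ-zero (∑-linear (×-finite FI FJ)) (λ v → ℚ.*-zeroˡ (f (inj₁ v)))) ⟩
    0ℚ + s
      ≡⟨ ℚ.+-identityˡ s ⟩
    s
      ≡⟨ ∑-tensor FJ FI (x i) (y j) (f ∘ inj₂) ⟩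
    tensor (apply FJ x) (apply FI y) (λ k l → f (inj₂ (k , l))) i j ∎
    where s = ∑ (×-finite FJ FI) (λ (k , l) → x i k * y j l * f (inj₂ (k , l)))

  operator-Board₂ : ∀ k l → operator (Board x y) F f (inj₂ (k , l))
    ≡ tensor (apply FI y) (apply FJ x) (λ i j → f (inj₁ (i , j))) k l
  operator-Board₂ k l = begin
    operator (Board x y) F f (inj₂ (k , l))
      ≡⟨ ∑-⊎ (×-finite FI FJ) (×-finite FJ FI) (λ v → weight (Board x y) (inj₂ (k , l)) v * f v) ⟩
    s + ∑ (×-finite FJ FI) (λ v → 0ℚ * f (inj₂ v))
      ≡⟨ cong (s +_) (ℓ-zero (∑-linear (×-finite FJ FI)) (λ v → ℚ.*-zeroˡ (f (inj₂ v)))) ⟩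
    s + 0ℚ
      ≡⟨ ℚ.+-identityʳ s ⟩
    s
      ≡⟨ ∑-tensor FI FJ (y k) (x l) (f ∘ inj₁) ⟩
    tensor (apply FI y) (apply FJ x) (λ i j → f (inj₁ (i , j))) k l ∎
    where s = ∑ (×-finite FI FJ) (λ (i , j) → y k i * x l j * f (inj₁ (i , j)))

-- The map is `U` tensor `V` on one colour class and `V` tensor `U` on the other. A step changes the
-- class of both coordinates at once, so it suffices to intertwine `x` and `y` separately.
Board-cong : ∀ {I J I′ J′ : Set} {x : I → J → ℚ} {y : J → I → ℚ} {x′ : I′ → J′ → ℚ} {y′ : J′ → I′ → ℚ}
  {U : Fun I → Fun I′} {V : Fun J → Fun J′}
  (FI : Finite I) (FJ : Finite J) (FI′ : Finite I′) (FJ′ : Finite J′) →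
  I ↔ I′ → J ↔ J′ → LinearIso U → LinearIso V →
  (∀ f → apply FJ′ x′ (V f) ≗ U (apply FJ x f)) →
  (∀ f → apply FI′ y′ (U f) ≗ V (apply FI y f)) →
  Board x y ≈ Board x′ y′
Board-cong {x = x} {y} {x′} {y′} {U} {V} FI FJ FI′ FJ′ β γ IU IV xV yU = record
  { finiteˡ = Board-finite FI FJ
  ; finiteʳ = Board-finite FI′ FJ′
  ; bijection = (β ×-↔ γ) ⊎-↔ (γ ×-↔ β)
  ; map = T
  ; isIso = record
    { linear = λ
      { (inj₁ (i′ , j′)) → ∘-linear (U.linear i′) (λ i → ∘-linear (V.linear j′) (restrict-linear (λ j → inj₁ (i , j))))
      ; (inj₂ (j′ , i′)) → ∘-linear (V.linear j′) (λ j → ∘-linear (U.linear i′) (restrict-linear (λ i → inj₂ (j , i)))) }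
    ; injective = λ p → λ
      { (inj₁ (i , j)) → tensor-injective IU IV _ (λ i′ j′ → p (inj₁ (i′ , j′))) i j
      ; (inj₂ (j , i)) → tensor-injective IV IU _ (λ j′ i′ → p (inj₂ (j′ , i′))) j i }
    ; surjective = λ g →
      let f₁ , p₁ = tensor-surjective IU IV (λ i′ j′ → g (inj₁ (i′ , j′)))
          f₂ , p₂ = tensor-surjective IV IU (λ j′ i′ → g (inj₂ (j′ , i′)))
      in [ (λ (i , j) → f₁ i j) , (λ (j , i) → f₂ j i) ]′ ,
         λ { (inj₁ (i′ , j′)) → p₁ i′ j′ ; (inj₂ (j′ , i′)) → p₂ j′ i′ }
    }
  ; commutes = λ f → λ
    { (inj₁ (i′ , j′)) → begin
        operator (Board x′ y′) (Board-finite FI′ FJ′) (T f) (inj₁ (i′ , j′))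
          ≡⟨ operator-Board₁ FI′ FJ′ x′ y′ (T f) i′ j′ ⟩
        tensor (apply FJ′ x′) (apply FI′ y′) (tensor V U (λ k l → f (inj₂ (k , l)))) i′ j′
          ≡⟨ tensor-commutes FJ FJ FJ′ FI FI′ U.linear V.linear V.linear U.linear x x′ y y′ xV yU _ i′ j′ ⟩
        tensor U V (tensor (apply FJ x) (apply FI y) (λ k l → f (inj₂ (k , l)))) i′ j′
          ≡⟨ ℓ-cong (U.linear i′) (λ i → ℓ-cong (V.linear j′) (λ j → operator-Board₁ FI FJ x y f i j)) ⟨
        T (operator (Board x y) (Board-finite FI FJ) f) (inj₁ (i′ , j′)) ∎
    ; (inj₂ (j′ , i′)) → begin
        operator (Board x′ y′) (Board-finite FI′ FJ′) (T f) (inj₂ (j′ , i′))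
          ≡⟨ operator-Board₂ FI′ FJ′ x′ y′ (T f) j′ i′ ⟩
        tensor (apply FI′ y′) (apply FJ′ x′) (tensor U V (λ k l → f (inj₁ (k , l)))) j′ i′
          ≡⟨ tensor-commutes FI FI FI′ FJ FJ′ V.linear U.linear U.linear V.linear y y′ x x′ yU xV _ j′ i′ ⟩
        tensor V U (tensor (apply FI y) (apply FJ x) (λ k l → f (inj₁ (k , l)))) j′ i′
          ≡⟨ ℓ-cong (V.linear j′) (λ j → ℓ-cong (U.linear i′) (λ i → operator-Board₂ FI FJ x y f j i)) ⟨
        T (operator (Board x y) (Board-finite FI FJ) f) (inj₂ (j′ , i′)) ∎ }
  }
  where
  module U = LinearIso IU
  module V = LinearIso IV
  T : Fun (Vertex (Board x y)) → Fun (Vertex (Board x′ y′))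
  T f (inj₁ (i′ , j′)) = tensor U V (λ i j → f (inj₁ (i , j))) i′ j′
  T f (inj₂ (j′ , i′)) = tensor V U (λ j i → f (inj₂ (j , i))) j′ i′

-- Division by integers, and differences along a path

half-cancel : ∀ {a b} → a + b ≡ 0ℚ → a - b ≡ 0ℚ → a ≡ 0ℚ × b ≡ 0ℚ
half-cancel {a} {b} eq eq′ =
  trans (solve 2 (λ a b → a := con ½ :* ((a :+ b) :+ (a :- b))) refl a b) (cong₂ (λ u v → ½ * (u + v)) eq eq′) ,
  trans (solve 2 (λ a b → b := con ½ :* ((a :+ b) :- (a :- b))) refl a b) (cong₂ (λ u v → ½ * (u - v)) eq eq′)

natural : ℕ → ℚ
natural zero    = 0ℚ
natural (suc n) = 1ℚ + natural n

sum-1 : ∀ n → sum {n} (λ _ → 1ℚ) ≡ natural n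
sum-1 zero    = refl
sum-1 (suc n) = cong (1ℚ +_) (sum-1 n)

natural-nonNegative : ∀ n → ℚ.NonNegative (natural n)
natural-nonNegative zero    = _
natural-nonNegative (suc n) = ℚ.nonNeg+nonNeg⇒nonNeg 1ℚ (natural n) {{natural-nonNegative n}}

natural-invertible : ∀ n → ∃[ r ] natural (suc n) * r ≡ 1ℚ
natural-invertible n = (1/ natural (suc n)) , ℚ.*-inverseʳ (natural (suc n))
  where
  instance
    _ : ℚ.NonZero (natural (suc n))
    _ = ℚ.pos⇒nonZero (natural (suc n)) {{ℚ.pos+nonNeg⇒pos 1ℚ (natural n) {{natural-nonNegative n}}}}

difference : ∀ {k} → Fun (Fin (suc k)) → Fun (Fin k)
difference f i = f (suc i) - f (inject₁ i)

difference-linear : ∀ {k} → Linear (difference {k})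
difference-linear i = +-linear (eval-linear (suc i)) (-‿linear (eval-linear (inject₁ i)))

difference-injective : ∀ {k} (f : Fun (Fin (suc k))) → (∀ i → difference f i ≡ 0ℚ) → ∀ i → f i ≡ f zero
difference-injective f p zero = refl
difference-injective {suc k} f p (suc i) = trans
  (difference-injective (f ∘ suc) (p ∘ suc) i)
  (trans (solve 2 (λ a b → a := (a :- b) :+ b) refl (f (suc zero)) (f zero))
         (trans (cong (_+ f zero) (p zero)) (ℚ.+-identityˡ (f zero))))

partialSums : ∀ {k} → Fun (Fin k) → Fun (Fin (suc k))
partialSums g zero = 0ℚ
partialSums {suc k} g (suc i) = g zero + partialSums (g ∘ suc) i

difference-partialSums : ∀ {k} (g : Fun (Fin k)) → difference (partialSums g) ≗ g
difference-partialSums g zero = solve 1 (λ a → (a :+ con 0ℚ) :- con 0ℚ := a) refl (g zero)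
difference-partialSums g (suc i) = trans
  (solve 3 (λ a b c → (a :+ b) :- (a :+ c) := b :- c) refl (g zero) _ _)
  (difference-partialSums (g ∘ suc) i)

withDifference : ∀ {k} → (Fun (Fin (suc k)) → ℚ) → Fun (Fin (suc k)) → Fun (Maybe (Fin k))
withDifference α f nothing  = α f
withDifference α f (just i) = difference f i

-- The kernel of `difference` consists of the constants, and `α` detects them as soon as its value
-- at 1 is invertible, with inverse `r`.
withDifference-iso : ∀ {k} {α : Fun (Fin (suc k)) → ℚ} → LinearForm α →
  ∀ r → α (λ _ → 1ℚ) * r ≡ 1ℚ → LinearIso (withDifference α)
withDifference-iso {k} {α} L r q*r≡1 = record
  { linear = λ { nothing → L ; (just i) → difference-linear i }
  ; injective = λ {f} p i → trans (f≡f₀ p i) (f₀≡0 p)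
  ; surjective = λ g → shifted g , λ { nothing → hits-nothing g ; (just i) → hits-just g i }
  }
  where
  q = α (λ _ → 1ℚ)
  module _ {f : Fun (Fin (suc k))} (p : ∀ y → withDifference α f y ≡ 0ℚ) where
    f≡f₀ : ∀ i → f i ≡ f zero
    f≡f₀ = difference-injective f (p ∘ just)
    f₀≡0 : f zero ≡ 0ℚ
    f₀≡0 = begin
      f zero                        ≡⟨ ℚ.*-identityʳ (f zero) ⟨
      f zero * 1ℚ                   ≡⟨ cong (f zero *_) q*r≡1 ⟨
      f zero * (q * r)              ≡⟨ ℚ.*-assoc (f zero) q r ⟨
      f zero * q * r                ≡⟨ cong (_* r) (homogeneous L (f zero) (λ _ → 1ℚ)) ⟨
      α (λ _ → f zero * 1ℚ) * r     ≡⟨ cong (_* r) (ℓ-cong L (λ i → trans (ℚ.*-identityʳ (f zero)) (sym (f≡f₀ i)))) ⟩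
      α f * r                       ≡⟨ cong (_* r) (p nothing) ⟩
      0ℚ * r                        ≡⟨ ℚ.*-zeroˡ r ⟩
      0ℚ                            ∎
  module _ (g : Fun (Maybe (Fin k))) where
    -- Partial sums already have the right differences; adding the constant `c` corrects the value
    -- of `α` without changing them.
    c = r * (g nothing - α (partialSums (g ∘ just)))
    shifted : Fun (Fin (suc k))
    shifted i = partialSums (g ∘ just) i + c * 1ℚ
    hits-nothing : α shifted ≡ g nothing
    hits-nothing = begin
      α shifted          ≡⟨ additive L (partialSums (g ∘ just)) (λ _ → c * 1ℚ) ⟩
      s + α (λ _ → c * 1ℚ)  ≡⟨ cong (s +_) (homogeneous L c (λ _ → 1ℚ)) ⟩
      s + r * (g nothing - s) * q ≡⟨ solve 4 (λ s r g q → s :+ r :* (g :- s) :* q := s :+ (q :* r) :* (g :- s)) refl s r (g nothing) q ⟩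
      s + (q * r) * (g nothing - s)    ≡⟨ cong (λ t → s + t * (g nothing - s)) q*r≡1 ⟩
      s + 1ℚ * (g nothing - s)         ≡⟨ solve 2 (λ s g → s :+ con 1ℚ :* (g :- s) := g) refl s (g nothing) ⟩
      g nothing          ∎
      where s = α (partialSums (g ∘ just))
    hits-just : ∀ i → difference shifted i ≡ g (just i)
    hits-just i = trans
      (solve 3 (λ a b c → (a :+ c) :- (b :+ c) := a :- b) refl (partialSums (g ∘ just) (suc i)) _ (c * 1ℚ))
      (difference-partialSums (g ∘ just) i)

-- The even points 0, 2, …, 2m and the odd points 1, 3, …, 2m − 1 of a path.

adjacent : ∀ {m} → Fin m → Fin (suc m) → ℚ
adjacent zero    zero          = 1ℚ
adjacent zero    (suc zero)    = 1ℚ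
adjacent zero    (suc (suc _)) = 0ℚ
adjacent (suc k) zero          = 0ℚ
adjacent (suc k) (suc i)       = adjacent k i

adjacentᵀ : ∀ {m} → Fin (suc m) → Fin m → ℚ
adjacentᵀ i k = adjacent k i

lastFactor : ∀ {m} → Fin m → ℚ
lastFactor {suc zero}    zero    = 2ℚ
lastFactor {suc (suc m)} zero    = 1ℚ
lastFactor               (suc i) = lastFactor i

endpointFactor : ∀ {m} → Fin (suc m) → ℚ
endpointFactor zero    = 2ℚ
endpointFactor (suc i) = lastFactor i

-- At an end point the single neighbour is reached twice, once directly and once by reflection. Rows
-- are scaled and columns are not, so this is not the transpose of `adjacent`.
reflectingᵀ : ∀ {m} → Fin (suc m) → Fin m → ℚ
reflectingᵀ i k = endpointFactor i * adjacent k i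

apply-adjacent : ∀ {m} (f : Fun (Fin (suc m))) k →
  apply (Fin-finite (suc m)) adjacent f k ≡ f (inject₁ k) + f (suc k)
apply-adjacent f zero = trans
  (cong (λ s → 1ℚ * f zero + (1ℚ * f (suc zero) + s))
        (ℓ-zero sum-linear (λ i → ℚ.*-zeroˡ (f (suc (suc i))))))
  (solve 2 (λ a b → con 1ℚ :* a :+ (con 1ℚ :* b :+ con 0ℚ) := a :+ b) refl (f zero) (f (suc zero)))
apply-adjacent f (suc k) = trans
  (cong₂ _+_ (ℚ.*-zeroˡ (f zero)) (apply-adjacent (f ∘ suc) k))
  (ℚ.+-identityˡ _)

-- Values at the odd points left and right of an even point: 0 outside the path
-- in the Dirichlet case, mirrored at the end points in the Neumann case.

leftDirichlet rightDirichlet : ∀ {m} → Fun (Fin m) → Fun (Fin (suc m))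
leftDirichlet g zero    = 0ℚ
leftDirichlet g (suc i) = g i
rightDirichlet {zero}  g zero    = 0ℚ
rightDirichlet {suc m} g zero    = g zero
rightDirichlet {suc m} g (suc i) = rightDirichlet (g ∘ suc) i

leftNeumann rightNeumann : ∀ {m} → Fun (Fin (suc m)) → Fun (Fin (suc (suc m)))
leftNeumann g zero    = g zero
leftNeumann g (suc i) = g i
rightNeumann         g zero       = g zero
rightNeumann {zero}  g (suc zero) = g zero
rightNeumann {suc m} g (suc i)    = rightNeumann (g ∘ suc) i

apply-adjacentᵀ : ∀ {m} (g : Fun (Fin m)) i →
  apply (Fin-finite m) adjacentᵀ g i ≡ leftDirichlet g i + rightDirichlet g i
apply-adjacentᵀ {zero}  g zero = refl
apply-adjacentᵀ {suc m} g zero = trans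
  (cong (1ℚ * g zero +_) (ℓ-zero sum-linear (λ k → ℚ.*-zeroˡ (g (suc k)))))
  (solve 1 (λ a → con 1ℚ :* a :+ con 0ℚ := con 0ℚ :+ a) refl (g zero))
apply-adjacentᵀ {suc m} g (suc i) = begin
  adjacent zero (suc i) * g zero + apply (Fin-finite m) adjacentᵀ (g ∘ suc) i
    ≡⟨ cong (a +_) (apply-adjacentᵀ (g ∘ suc) i) ⟩
  a + (leftDirichlet (g ∘ suc) i + r)   ≡⟨ ℚ.+-assoc a _ r ⟨
  (a + leftDirichlet (g ∘ suc) i) + r   ≡⟨ cong (_+ r) (left i) ⟩
  g i + r                               ∎
  where
  a = adjacent zero (suc i) * g zero
  r = rightDirichlet (g ∘ suc) i
  -- The first odd point supplies `g zero` exactly where `leftDirichlet` of the tail has its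
  -- boundary value 0.
  left : ∀ i → adjacent zero (suc i) * g zero + leftDirichlet (g ∘ suc) i ≡ g i
  left zero    = solve 1 (λ a → con 1ℚ :* a :+ con 0ℚ := a) refl (g zero)
  left (suc i) = solve 2 (λ a b → con 0ℚ :* a :+ b := b) refl (g zero) (g (suc i))

-- At an end point one of the two Dirichlet values is 0, and doubling the other has the same effect
-- as mirroring it. There must be an odd point to mirror, hence the index `suc m`.
endpointFactor-reflects : ∀ {m} (g : Fun (Fin (suc m))) i →
  endpointFactor i * (leftDirichlet g i + rightDirichlet g i) ≡ leftNeumann g i + rightNeumann g i
endpointFactor-reflects g zero = solve 1 (λ a → con 2ℚ :* (con 0ℚ :+ a) := a :+ a) refl (g zero)
endpointFactor-reflects g (suc i) = last g i
  where
  last : ∀ {m} (g : Fun (Fin (suc m))) i →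
    lastFactor i * (g i + rightDirichlet (g ∘ suc) i) ≡ g i + rightNeumann g (suc i)
  last {zero}  g zero    = solve 1 (λ a → con 2ℚ :* (a :+ con 0ℚ) := a :+ a) refl (g zero)
  last {suc m} g zero    = ℚ.*-identityˡ _
  last {suc m} g (suc i) = last (g ∘ suc) i

apply-reflectingᵀ : ∀ {m} (g : Fun (Fin (suc m))) i →
  apply (Fin-finite (suc m)) reflectingᵀ g i ≡ leftNeumann g i + rightNeumann g i
apply-reflectingᵀ {m} g i = begin
  apply (Fin-finite (suc m)) reflectingᵀ g i
    ≡⟨ ℓ-cong (sum-linear) (λ k → ℚ.*-assoc (endpointFactor i) (adjacent k i) (g k)) ⟩
  sum (λ k → endpointFactor i * (adjacent k i * g k))
    ≡⟨ homogeneous sum-linear (endpointFactor i) (λ k → adjacent k i * g k) ⟩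
  endpointFactor i * apply (Fin-finite (suc m)) adjacentᵀ g i
    ≡⟨ cong (endpointFactor i *_) (apply-adjacentᵀ g i) ⟩
  endpointFactor i * (leftDirichlet g i + rightDirichlet g i)
    ≡⟨ endpointFactor-reflects g i ⟩
  leftNeumann g i + rightNeumann g i ∎

-- Across the mirror the increment of `g` is 0, which is the Dirichlet value of `difference g`. This
-- is how differencing turns reflection into a zero boundary condition.
leftNeumann-inject₁ : ∀ {m} (g : Fun (Fin (suc m))) i →
  leftNeumann g (inject₁ i) ≡ g i - leftDirichlet (difference g) i
leftNeumann-inject₁ g zero    = solve 1 (λ a → a := a :- con 0ℚ) refl (g zero)
leftNeumann-inject₁ {suc m} g (suc i) =
  solve 2 (λ a b → b := a :- (a :- b)) refl (g (suc i)) (g (inject₁ i))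

rightNeumann-suc : ∀ {m} (g : Fun (Fin (suc m))) i →
  rightNeumann g (suc i) ≡ g i + rightDirichlet (difference g) i
rightNeumann-suc {zero}  g zero    = sym (ℚ.+-identityʳ (g zero))
rightNeumann-suc {suc m} g zero    = solve 2 (λ a b → b := a :+ (b :- a)) refl (g zero) (g (suc zero))
rightNeumann-suc {suc m} g (suc i) = rightNeumann-suc (g ∘ suc) i

rightNeumann-inject₁ : ∀ {m} (g : Fun (Fin (suc m))) i → rightNeumann g (inject₁ i) ≡ g i
rightNeumann-inject₁ g zero            = refl
rightNeumann-inject₁ {suc m} g (suc i) = rightNeumann-inject₁ (g ∘ suc) i

sum-rightDirichlet : ∀ {m} (g : Fun (Fin m)) → sum (rightDirichlet g) ≡ sum g
sum-rightDirichlet {zero}  g = refl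
sum-rightDirichlet {suc m} g = cong (g zero +_) (sum-rightDirichlet (g ∘ suc))

-- Direct sum with a block of size one. Its entry 2 is the factor by which the sums over the two
-- parity classes are carried into each other.
augment : {I J : Set} → (I → J → ℚ) → Maybe I → Maybe J → ℚ
augment w (just i) (just j) = w i j
augment w (just i) nothing  = 0ℚ
augment w nothing  (just j) = 0ℚ
augment w nothing  nothing  = 2ℚ

module _ {I J : Set} (F : Finite J) (w : I → J → ℚ) (f : Fun (Maybe J)) where

  apply-augment-just : ∀ i → apply (Maybe-finite F) (augment w) f (just i) ≡ apply F w (f ∘ just) i
  apply-augment-just i = trans (∑-Maybe F (λ j → augment w (just i) j * f j))
    (solve 2 (λ a b → con 0ℚ :* a :+ b := b) refl (f nothing) _)

  apply-augment-nothing : apply (Maybe-finite F) (augment w) f nothing ≡ 2ℚ * f nothing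
  apply-augment-nothing = trans (∑-Maybe F (λ j → augment w nothing j * f j)) (trans
    (cong (2ℚ * f nothing +_) (ℓ-zero (∑-linear F) (λ j → ℚ.*-zeroˡ (f (just j)))))
    (ℚ.+-identityʳ _))

-- The sum over the even points, with the two end points counted half.

evenSum : ∀ {m} → Fun (Fin (suc m)) → ℚ
evenSum f = ½ * sum (λ k → f (inject₁ k) + f (suc k))

evenSum-linear : ∀ {m} → LinearForm (evenSum {m})
evenSum-linear = *-linear ½ (∘-linear sum-linear (λ k → +-linear (eval-linear (inject₁ k)) (eval-linear (suc k))))

evenSum-1 : ∀ m → evenSum {m} (λ _ → 1ℚ) ≡ natural m
evenSum-1 m = begin
  ½ * sum {m} (λ _ → 2ℚ * 1ℚ)     ≡⟨ cong (½ *_) (homogeneous (sum-linear {m}) 2ℚ (λ _ → 1ℚ)) ⟩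
  ½ * (2ℚ * sum {m} (λ _ → 1ℚ)) ≡⟨ cong (λ s → ½ * (2ℚ * s)) (sum-1 m) ⟩
  ½ * (2ℚ * natural m)          ≡⟨ solve 1 (λ a → con ½ :* (con 2ℚ :* a) := a) refl (natural m) ⟩
  natural m                     ∎

evenTransform : ∀ {m} → Fun (Fin (suc m)) → Fun (Maybe (Fin m))
evenTransform = withDifference evenSum

oddTransform : ∀ {m} → Fun (Fin (suc m)) → Fun (Maybe (Fin m))
oddTransform = withDifference sum

evenTransform-iso : ∀ {m} → LinearIso (evenTransform {suc m})
evenTransform-iso {m} = let r , p = natural-invertible m in
  withDifference-iso evenSum-linear r (trans (cong (_* r) (evenSum-1 (suc m))) p)

oddTransform-iso : ∀ {m} → LinearIso (oddTransform {m})
oddTransform-iso {m} = let r , p = natural-invertible m in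
  withDifference-iso sum-linear r (trans (cong (_* r) (sum-1 (suc m))) p)

-- Summing both neighbours over all odd points counts an inner even point twice and an end point
-- once, which is twice `evenSum`. Away from `nothing`, differencing commutes with adding
-- neighbours.
transform-adjacent : ∀ {m} (f : Fun (Fin (suc (suc m)))) →
  apply (Maybe-finite (Fin-finite (suc m))) (augment adjacent) (evenTransform f)
    ≗ oddTransform (apply (Fin-finite (suc (suc m))) adjacent f)
transform-adjacent {m} f nothing = begin
  apply (Maybe-finite (Fin-finite (suc m))) (augment (adjacent {m})) (evenTransform f) nothing
    ≡⟨ apply-augment-nothing (Fin-finite (suc m)) (adjacent {m}) (evenTransform f) ⟩
  2ℚ * (½ * s)  ≡⟨ solve 1 (λ a → con 2ℚ :* (con ½ :* a) := a) refl s ⟩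
  s             ≡⟨ ℓ-cong sum-linear (apply-adjacent f) ⟨
  sum (apply (Fin-finite (suc (suc m))) adjacent f) ∎
  where s = sum (λ k → f (inject₁ k) + f (suc k))
transform-adjacent {m} f (just k) = begin
  apply (Maybe-finite (Fin-finite (suc m))) (augment adjacent) (evenTransform f) (just k)
    ≡⟨ apply-augment-just (Fin-finite (suc m)) adjacent (evenTransform f) k ⟩
  apply (Fin-finite (suc m)) adjacent (difference f) k
    ≡⟨ apply-adjacent (difference f) k ⟩
  difference f (inject₁ k) + difference f (suc k)
    ≡⟨ solve 3 (λ a b c → (a :- b) :+ (c :- a) := (a :+ c) :- (b :+ a)) refl
         (f (suc (inject₁ k))) (f (inject₁ (inject₁ k))) (f (suc (suc k))) ⟩
  (f (inject₁ (suc k)) + f (suc (suc k))) - (f (inject₁ (inject₁ k)) + f (suc (inject₁ k)))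
    ≡⟨ cong₂ _-_ (apply-adjacent f (suc k)) (apply-adjacent f (inject₁ k)) ⟨
  difference (apply (Fin-finite (suc (suc m))) adjacent f) k ∎

-- For the sums, the values at the two even neighbours of an odd point add up to 4 times the value
-- of `g` there plus an increment to the right minus one to the left. These corrections cancel in
-- total, and the factor ½ leaves 2.
transform-reflectingᵀ : ∀ {m} (g : Fun (Fin (suc m))) →
  apply (Maybe-finite (Fin-finite m)) (augment adjacentᵀ) (oddTransform g)
    ≗ evenTransform (apply (Fin-finite (suc m)) reflectingᵀ g)
transform-reflectingᵀ {m} g nothing = begin
  apply (Maybe-finite (Fin-finite m)) (augment (adjacentᵀ {m})) (oddTransform g) nothing
    ≡⟨ apply-augment-nothing (Fin-finite m) (adjacentᵀ {m}) (oddTransform g) ⟩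
  2ℚ * sum g
    -- The inserted zero is the difference of the two correction sums; `0ℚ + sum d` is the form to
    -- which the sum of `leftDirichlet d` reduces.
    ≡⟨ solve 2 (λ s d → con 2ℚ :* s := con ½ :* (con (2ℚ + 2ℚ) :* s :+ (d :- (con 0ℚ :+ d)))) refl (sum g) (sum d) ⟩
  ½ * ((2ℚ + 2ℚ) * sum g + (sum d - (0ℚ + sum d)))
    ≡⟨ cong (λ t → ½ * ((2ℚ + 2ℚ) * sum g + (t - (0ℚ + sum d)))) (sum-rightDirichlet d) ⟨
  ½ * ((2ℚ + 2ℚ) * sum g + (sum (rightDirichlet d) - sum (leftDirichlet d)))
    ≡⟨ cong (½ *_) (cong₂ _+_ (homogeneous sum-linear (2ℚ + 2ℚ) g) (ℓ-diff sum-linear (rightDirichlet d) (leftDirichlet d))) ⟨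
  ½ * (sum (λ k → (2ℚ + 2ℚ) * g k) + sum (λ k → rightDirichlet d k - leftDirichlet d k))
    ≡⟨ cong (½ *_) (additive sum-linear (λ k → (2ℚ + 2ℚ) * g k) (λ k → rightDirichlet d k - leftDirichlet d k)) ⟨
  ½ * sum (λ k → (2ℚ + 2ℚ) * g k + (rightDirichlet d k - leftDirichlet d k))
    ≡⟨ cong (½ *_) (sum-cong-≗ summand) ⟨
  evenTransform (apply (Fin-finite (suc m)) reflectingᵀ g) nothing ∎
  where
  d = difference g
  x = apply (Fin-finite (suc m)) reflectingᵀ g
  summand : ∀ k → x (inject₁ k) + x (suc k) ≡ (2ℚ + 2ℚ) * g k + (rightDirichlet d k - leftDirichlet d k)
  summand k = begin
    x (inject₁ k) + x (suc k)
      ≡⟨ cong₂ _+_ (apply-reflectingᵀ g (inject₁ k)) (apply-reflectingᵀ g (suc k)) ⟩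
    (leftNeumann g (inject₁ k) + rightNeumann g (inject₁ k)) + (g k + rightNeumann g (suc k))
      ≡⟨ cong₂ _+_ (cong₂ _+_ (leftNeumann-inject₁ g k) (rightNeumann-inject₁ g k)) (cong (g k +_) (rightNeumann-suc g k)) ⟩
    ((g k - leftDirichlet d k) + g k) + (g k + (g k + rightDirichlet d k))
      ≡⟨ solve 3 (λ a l r → ((a :- l) :+ a) :+ (a :+ (a :+ r)) := con (2ℚ + 2ℚ) :* a :+ (r :- l)) refl
           (g k) (leftDirichlet d k) (rightDirichlet d k) ⟩
    (2ℚ + 2ℚ) * g k + (rightDirichlet d k - leftDirichlet d k) ∎
transform-reflectingᵀ {m} g (just i) = begin
  apply (Maybe-finite (Fin-finite m)) (augment adjacentᵀ) (oddTransform g) (just i)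
    ≡⟨ apply-augment-just (Fin-finite m) adjacentᵀ (oddTransform g) i ⟩
  apply (Fin-finite m) adjacentᵀ d i
    ≡⟨ apply-adjacentᵀ d i ⟩
  leftDirichlet d i + rightDirichlet d i
    ≡⟨ solve 3 (λ a l r → l :+ r := (a :+ (a :+ r)) :- ((a :- l) :+ a)) refl (g i) (leftDirichlet d i) (rightDirichlet d i) ⟩
  (g i + (g i + rightDirichlet d i)) - ((g i - leftDirichlet d i) + g i)
    ≡⟨ cong₂ _-_ (cong (g i +_) (rightNeumann-suc g i)) (cong₂ _+_ (leftNeumann-inject₁ g i) (rightNeumann-inject₁ g i)) ⟨
  (g i + rightNeumann g (suc i)) - (leftNeumann g (inject₁ i) + rightNeumann g (inject₁ i))
    ≡⟨ cong₂ _-_ (apply-reflectingᵀ g (suc i)) (apply-reflectingᵀ g (inject₁ i)) ⟨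
  difference (apply (Fin-finite (suc m)) reflectingᵀ g) i ∎
  where d = difference g

Fin-suc↔Maybe : ∀ {k} → Fin (suc k) ↔ Maybe (Fin k)
Fin-suc↔Maybe = mk↔ₛ′ (λ { zero → nothing ; (suc i) → just i }) (λ { nothing → zero ; (just i) → suc i })
  (λ { nothing → refl ; (just _) → refl }) (λ { zero → refl ; (suc _) → refl })

-- Differences of even values live at odd positions. Moving the positions 1, ..., 2m + 1 down by one
-- makes them the even class of the shorter path, so the roles of the two classes in `Board` are
-- kept.
reflectingBoard≈augmentedBoard : ∀ m →
  Board (reflectingᵀ {suc m}) adjacent ≈ Board (augment (adjacentᵀ {m})) (augment adjacent)
reflectingBoard≈augmentedBoard m = Board-cong
  (Fin-finite (suc (suc m))) (Fin-finite (suc m)) (Maybe-finite (Fin-finite (suc m))) (Maybe-finite (Fin-finite m))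
  Fin-suc↔Maybe Fin-suc↔Maybe evenTransform-iso oddTransform-iso
  transform-reflectingᵀ transform-adjacent

-- Diagonal coordinates on the Aztec diamond

module _ where

  open import Data.Integer.Base using (+_)

  ∣i+j∣≡⊎∣i-j∣≡ : ∀ i j → (∣ i ℤ.+ j ∣ ≡ ∣ i ∣ ℕ.+ ∣ j ∣) ⊎ (∣ i ℤ.- j ∣ ≡ ∣ i ∣ ℕ.+ ∣ j ∣)
  ∣i+j∣≡⊎∣i-j∣≡ (+ m)    (+ n)       = inj₁ refl
  ∣i+j∣≡⊎∣i-j∣≡ (+ m)    -[1+ n ]    = inj₂ refl
  ∣i+j∣≡⊎∣i-j∣≡ -[1+ m ] -[1+ n ]    = inj₁ (cong suc (sym (ℕ.+-suc m n)))
  ∣i+j∣≡⊎∣i-j∣≡ -[1+ m ] (+ zero)    = inj₂ (cong suc (sym (ℕ.+-identityʳ m)))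
  ∣i+j∣≡⊎∣i-j∣≡ -[1+ m ] (+ (suc n)) = inj₂ (cong suc (sym (ℕ.+-suc m n)))

  -- One of the two attains the sum, depending on the signs, and the triangle inequality bounds the
  -- other. This rotates the diamond into a square and taxicab distance into maximum distance.
  ∣i∣+∣j∣≡∣i+j∣⊔∣i-j∣ : ∀ i j → ∣ i ∣ ℕ.+ ∣ j ∣ ≡ ∣ i ℤ.+ j ∣ ⊔ ∣ i ℤ.- j ∣
  ∣i∣+∣j∣≡∣i+j∣⊔∣i-j∣ i j with ∣i+j∣≡⊎∣i-j∣≡ i j
  ... | inj₁ eq = sym (trans (ℕ.m≥n⇒m⊔n≡m (ℕ.≤-trans (ℤ.∣i-j∣≤∣i∣+∣j∣ i j) (ℕ.≤-reflexive (sym eq)))) eq)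
  ... | inj₂ eq = sym (trans (ℕ.m≤n⇒m⊔n≡n (ℕ.≤-trans (ℤ.∣i+j∣≤∣i∣+∣j∣ i j) (ℕ.≤-reflexive (sym eq)))) eq)

  -- The diagonal coordinates x + y and x − y of the point (a + 1/2 , b + 1/2).

  diagonal antidiagonal : HalfPoint → ℤ
  diagonal     (a , b) = a ℤ.+ b ℤ.+ + 1
  antidiagonal (a , b) = a ℤ.- b

  twiceNorm≡ : ∀ p → twiceNorm p ≡ 2 ℕ.* (∣ diagonal p ∣ ⊔ ∣ antidiagonal p ∣)
  twiceNorm≡ p@(a , b) = begin
    ∣ x ∣ ℕ.+ ∣ y ∣                              ≡⟨ ∣i∣+∣j∣≡∣i+j∣⊔∣i-j∣ x y ⟩
    ∣ x ℤ.+ y ∣ ⊔ ∣ x ℤ.- y ∣                    ≡⟨ cong₂ (λ u v → ∣ u ∣ ⊔ ∣ v ∣)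
      (ZS.solve 2 (λ a b → (con2 ZS.:* a ZS.:+ con1) ZS.:+ (con2 ZS.:* b ZS.:+ con1) ZS.:= con2 ZS.:* (a ZS.:+ b ZS.:+ con1)) refl a b)
      (ZS.solve 2 (λ a b → (con2 ZS.:* a ZS.:+ con1) ZS.:- (con2 ZS.:* b ZS.:+ con1) ZS.:= con2 ZS.:* (a ZS.:- b)) refl a b) ⟩
    ∣ + 2 ℤ.* diagonal p ∣ ⊔ ∣ + 2 ℤ.* antidiagonal p ∣
      ≡⟨ cong₂ _⊔_ (ℤ.abs-* (+ 2) (diagonal p)) (ℤ.abs-* (+ 2) (antidiagonal p)) ⟩
    (2 ℕ.* ∣ diagonal p ∣) ⊔ (2 ℕ.* ∣ antidiagonal p ∣)
      ≡⟨ ℕ.*-distribˡ-⊔ 2 ∣ diagonal p ∣ ∣ antidiagonal p ∣ ⟨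
    2 ℕ.* (∣ diagonal p ∣ ⊔ ∣ antidiagonal p ∣)  ∎
    where
    x = + 2 ℤ.* a ℤ.+ + 1
    y = + 2 ℤ.* b ℤ.+ + 1
    con1 con2 : ∀ {n} → ZS.Polynomial n
    con1 = ZS.con (+ 1)
    con2 = ZS.con (+ 2)

  taxicab≡ : ∀ ((a , b) (c , d) : HalfPoint) → ∣ a ℤ.- c ∣ ℕ.+ ∣ b ℤ.- d ∣ ≡
    ∣ diagonal (a , b) ℤ.- diagonal (c , d) ∣ ⊔ ∣ antidiagonal (a , b) ℤ.- antidiagonal (c , d) ∣
  taxicab≡ (a , b) (c , d) = trans (∣i∣+∣j∣≡∣i+j∣⊔∣i-j∣ (a ℤ.- c) (b ℤ.- d)) (cong₂ (λ u v → ∣ u ∣ ⊔ ∣ v ∣)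
    (ZS.solve 4 (λ a b c d → (a ZS.:- c) ZS.:+ (b ZS.:- d) ZS.:= (a ZS.:+ b ZS.:+ ZS.con (+ 1)) ZS.:- (c ZS.:+ d ZS.:+ ZS.con (+ 1))) refl a b c d)
    (ZS.solve 4 (λ a b c d → (a ZS.:- c) ZS.:- (b ZS.:- d) ZS.:= (a ZS.:- b) ZS.:- (c ZS.:- d)) refl a b c d))

  double-diagonals : ∀ ((a , b) : HalfPoint) → diagonal (a , b) ℤ.+ antidiagonal (a , b) ≡ + 2 ℤ.* a ℤ.+ + 1
  double-diagonals (a , b) = ZS.solve 2 (λ a b →
    (a ZS.:+ b ZS.:+ ZS.con (+ 1)) ZS.:+ (a ZS.:- b) ZS.:= ZS.con (+ 2) ZS.:* a ZS.:+ ZS.con (+ 1)) refl a b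

  diagonals-injective : ∀ p q → diagonal p ≡ diagonal q → antidiagonal p ≡ antidiagonal q → p ≡ q
  diagonals-injective p@(a , b) q@(c , d) eq eq′ = cong₂ _,_ a≡c b≡d
    where
    a≡c : a ≡ c
    a≡c = ℤ.*-cancelˡ-≡ (+ 2) a c (ℤ-Group.∙-cancelʳ (+ 1) _ _
      (trans (sym (double-diagonals p)) (trans (cong₂ ℤ._+_ eq eq′) (double-diagonals q))))
    b≡d : b ≡ d
    b≡d = begin
      b                        ≡⟨ ZS.solve 2 (λ a b → b ZS.:= a ZS.:- (a ZS.:- b)) refl a b ⟩
      a ℤ.- antidiagonal p     ≡⟨ cong₂ ℤ._-_ a≡c eq′ ⟩
      c ℤ.- antidiagonal q     ≡⟨ ZS.solve 2 (λ a b → b ZS.:= a ZS.:- (a ZS.:- b)) refl c d ⟨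
      d                        ∎

  even≢odd : ∀ m n → 2 ℕ.* m ≢ suc (2 ℕ.* n)
  even≢odd (suc m) zero    eq = ℕ.m+1+n≢0 m (ℕ.suc-injective eq)
  even≢odd (suc m) (suc n) eq = even≢odd m n (ℕ.suc-injective (begin
    suc (2 ℕ.* m)       ≡⟨ ℕ.+-suc m (m ℕ.+ 0) ⟨
    m ℕ.+ suc (m ℕ.+ 0) ≡⟨ ℕ.suc-injective eq ⟩
    2 ℕ.* suc n         ≡⟨ cong suc (ℕ.+-suc n (n ℕ.+ 0)) ⟩
    suc (suc (2 ℕ.* n)) ∎))

  even≢oddℤ : ∀ i j → + 2 ℤ.* i ≢ + 2 ℤ.* j ℤ.+ + 1
  even≢oddℤ i j eq = even≢odd ∣ i ℤ.- j ∣ 0 (begin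
    2 ℕ.* ∣ i ℤ.- j ∣                  ≡⟨ ℤ.abs-* (+ 2) (i ℤ.- j) ⟨
    ∣ + 2 ℤ.* (i ℤ.- j) ∣              ≡⟨ cong ∣_∣ (ZS.solve 2 (λ i j → ZS.con (+ 2) ZS.:* (i ZS.:- j)
                                            ZS.:= ZS.con (+ 2) ZS.:* i ZS.:- ZS.con (+ 2) ZS.:* j) refl i j) ⟩
    ∣ + 2 ℤ.* i ℤ.- + 2 ℤ.* j ∣        ≡⟨ cong (λ u → ∣ u ℤ.- + 2 ℤ.* j ∣) eq ⟩
    ∣ + 2 ℤ.* j ℤ.+ + 1 ℤ.- + 2 ℤ.* j ∣ ≡⟨ cong ∣_∣ (ZS.solve 1 (λ j → j ZS.:+ ZS.con (+ 1) ZS.:- j ZS.:= ZS.con (+ 1)) refl (+ 2 ℤ.* j)) ⟩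
    1                                  ∎)

  data Parity : ℕ → Set where
    even : ∀ k → Parity (2 ℕ.* k)
    odd  : ∀ k → Parity (suc (2 ℕ.* k))

  parity : ∀ r → Parity r
  parity zero = even 0
  parity (suc r) with parity r
  ... | even k = odd k
  ... | odd k  = subst Parity (cong suc (ℕ.+-suc k (k ℕ.+ 0))) (even (suc k))

  -- Shifted by n, the diagonal coordinates of the vertices of AD n are the pairs
  -- of numbers in {0, …, 2n} of opposite parity.

  evenPosition : ∀ {n} → Fin (suc n) → ℕ
  evenPosition i = 2 ℕ.* toℕ i

  oddPosition : ∀ {n} → Fin n → ℕ
  oddPosition k = suc (2 ℕ.* toℕ k)

  Cell : ℕ → Set
  Cell n = (Fin (suc n) × Fin n) ⊎ (Fin n × Fin (suc n))

  Cell-finite : ∀ n → Finite (Cell n)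
  Cell-finite n = Board-finite (Fin-finite (suc n)) (Fin-finite n)

  diagonalPosition antidiagonalPosition : ∀ {n} → Cell n → ℕ
  diagonalPosition     (inj₁ (i , j)) = evenPosition i
  diagonalPosition     (inj₂ (k , l)) = oddPosition k
  antidiagonalPosition (inj₁ (i , j)) = oddPosition j
  antidiagonalPosition (inj₂ (k , l)) = evenPosition l

  -- The solution of a + b + 1 = s - n and a - b = t - n for the positions s and t of the cell.
  -- Opposite parity of s and t is what makes it integral.
  cellPoint : ∀ {n} → Cell n → HalfPoint
  cellPoint {n} (inj₁ (i , j)) = + toℕ i ℤ.+ + toℕ j ℤ.- + n , + toℕ i ℤ.- + toℕ j ℤ.- + 1
  cellPoint {n} (inj₂ (k , l)) = + toℕ k ℤ.+ + toℕ l ℤ.- + n , + toℕ k ℤ.- + toℕ l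

  +-double : ∀ i → + (2 ℕ.* i) ≡ + 2 ℤ.* + i
  +-double i = ℤ.pos-* 2 i

  diagonal-cellPoint : ∀ {n} (c : Cell n) → diagonal (cellPoint c) ≡ + diagonalPosition c ℤ.- + n
  diagonal-cellPoint {n} (inj₁ (i , j)) = trans
    (ZS.solve 3 (λ i j n → (i ZS.:+ j ZS.:- n) ZS.:+ (i ZS.:- j ZS.:- ZS.con (+ 1)) ZS.:+ ZS.con (+ 1)
       ZS.:= ZS.con (+ 2) ZS.:* i ZS.:- n) refl (+ toℕ i) (+ toℕ j) (+ n))
    (cong (ℤ._- + n) (sym (+-double (toℕ i))))
  diagonal-cellPoint {n} (inj₂ (k , l)) = trans
    (ZS.solve 3 (λ k l n → (k ZS.:+ l ZS.:- n) ZS.:+ (k ZS.:- l) ZS.:+ ZS.con (+ 1)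
       ZS.:= ZS.con (+ 1) ZS.:+ ZS.con (+ 2) ZS.:* k ZS.:- n) refl (+ toℕ k) (+ toℕ l) (+ n))
    (cong (λ u → + 1 ℤ.+ u ℤ.- + n) (sym (+-double (toℕ k))))

  antidiagonal-cellPoint : ∀ {n} (c : Cell n) → antidiagonal (cellPoint c) ≡ + antidiagonalPosition c ℤ.- + n
  antidiagonal-cellPoint {n} (inj₁ (i , j)) = trans
    (ZS.solve 3 (λ i j n → (i ZS.:+ j ZS.:- n) ZS.:- (i ZS.:- j ZS.:- ZS.con (+ 1))
       ZS.:= ZS.con (+ 1) ZS.:+ ZS.con (+ 2) ZS.:* j ZS.:- n) refl (+ toℕ i) (+ toℕ j) (+ n))
    (cong (λ u → + 1 ℤ.+ u ℤ.- + n) (sym (+-double (toℕ j))))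
  antidiagonal-cellPoint {n} (inj₂ (k , l)) = trans
    (ZS.solve 3 (λ k l n → (k ZS.:+ l ZS.:- n) ZS.:- (k ZS.:- l)
       ZS.:= ZS.con (+ 2) ZS.:* l ZS.:- n) refl (+ toℕ k) (+ toℕ l) (+ n))
    (cong (ℤ._- + n) (sym (+-double (toℕ l))))

  ∣+m-+n∣ : ∀ m n → ∣ + m ℤ.- + n ∣ ≡ ∣ m ⊝ n ∣
  ∣+m-+n∣ m n = trans (cong ∣_∣ (ℤ.m-n≡m⊖n m n)) (∣m⊖n∣ m n)
    where
    ∣m⊖n∣ : ∀ m n → ∣ m ℤ.⊖ n ∣ ≡ ∣ m ⊝ n ∣
    ∣m⊖n∣ zero    zero    = refl
    ∣m⊖n∣ zero    (suc n) = refl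
    ∣m⊖n∣ (suc m) zero    = refl
    ∣m⊖n∣ (suc m) (suc n) = trans (cong ∣_∣ (ℤ.[1+m]⊖[1+n]≡m⊖n m n)) (∣m⊖n∣ m n)

  twiceNorm-cellPoint : ∀ {n} (c : Cell n) →
    twiceNorm (cellPoint c) ≡ 2 ℕ.* (∣ diagonalPosition c ⊝ n ∣ ⊔ ∣ antidiagonalPosition c ⊝ n ∣)
  twiceNorm-cellPoint {n} c = trans (twiceNorm≡ (cellPoint c)) (cong₂ (λ u v → 2 ℕ.* (u ⊔ v))
    (trans (cong ∣_∣ (diagonal-cellPoint c)) (∣+m-+n∣ (diagonalPosition c) n))
    (trans (cong ∣_∣ (antidiagonal-cellPoint c)) (∣+m-+n∣ (antidiagonalPosition c) n)))

  gridWeight-cellPoint : ∀ {n} (c d : Cell n) → gridWeight (cellPoint c) (cellPoint d) ≡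
    (if does ((∣ diagonalPosition c ⊝ diagonalPosition d ∣ ⊔ ∣ antidiagonalPosition c ⊝ antidiagonalPosition d ∣) ℕ.≟ 1)
     then 1ℚ else 0ℚ)
  gridWeight-cellPoint {n} c d = cong (λ r → if does (r ℕ.≟ 1) then 1ℚ else 0ℚ)
    (trans (taxicab≡ (cellPoint c) (cellPoint d)) (cong₂ _⊔_
      (coordinate _ _ (diagonal-cellPoint c) (diagonal-cellPoint d))
      (coordinate _ _ (antidiagonal-cellPoint c) (antidiagonal-cellPoint d))))
    where
    coordinate : ∀ {s t} x y → s ≡ + x ℤ.- + n → t ≡ + y ℤ.- + n → ∣ s ℤ.- t ∣ ≡ ∣ x ⊝ y ∣
    coordinate {s} {t} x y eq eq′ = begin
      ∣ s ℤ.- t ∣                              ≡⟨ cong₂ (λ u v → ∣ u ℤ.- v ∣) eq eq′ ⟩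
      ∣ (+ x ℤ.- + n) ℤ.- (+ y ℤ.- + n) ∣      ≡⟨ cong ∣_∣ (ZS.solve 3 (λ x y n → (x ZS.:- n) ZS.:- (y ZS.:- n) ZS.:= x ZS.:- y)
                                                    refl (+ x) (+ y) (+ n)) ⟩
      ∣ + x ℤ.- + y ∣                          ≡⟨ ∣+m-+n∣ x y ⟩
      ∣ x ⊝ y ∣                                ∎

  m≤2n⇒∣m-n∣≤n : ∀ {m n} → m ℕ.≤ 2 ℕ.* n → ∣ m ⊝ n ∣ ℕ.≤ n
  m≤2n⇒∣m-n∣≤n {m} {n} m≤2n with ℕ.∣m-n∣≡[m∸n]∨[n∸m] m n
  ... | inj₁ eq = subst (ℕ._≤ n) (sym eq) (ℕ.m≤n+o⇒m∸n≤o m n (subst (m ℕ.≤_) (cong (n ℕ.+_) (ℕ.+-identityʳ n)) m≤2n))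
  ... | inj₂ eq = subst (ℕ._≤ n) (sym eq) (ℕ.m∸n≤m n m)

  m<2n⇒∣m-n∣<n : ∀ {m n} → 0 ℕ.< m → m ℕ.< 2 ℕ.* n → ∣ m ⊝ n ∣ ℕ.< n
  m<2n⇒∣m-n∣<n {m} {zero} 0<m ()
  m<2n⇒∣m-n∣<n {suc m} {suc n} 0<m m<2n = s≤s (m≤2n⇒∣m-n∣≤n (ℕ.s≤s⁻¹ (subst (suc m ℕ.≤_) (ℕ.+-suc n (n ℕ.+ 0)) (ℕ.s≤s⁻¹ m<2n))))

  evenPosition≤ : ∀ {n} (i : Fin (suc n)) → evenPosition i ℕ.≤ 2 ℕ.* n
  evenPosition≤ i = ℕ.*-monoʳ-≤ 2 (Fin.toℕ≤pred[n] i)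

  oddPosition< : ∀ {n} (k : Fin n) → oddPosition k ℕ.< 2 ℕ.* n
  oddPosition< {n} k = ℕ.≤-trans
    (ℕ.≤-reflexive (cong suc (sym (ℕ.+-suc (toℕ k) (toℕ k ℕ.+ 0)))))
    (ℕ.*-monoʳ-≤ 2 (Fin.toℕ<n k))

  cellVertex : ∀ {n} → Cell n → ADVertex n
  cellVertex {n} c = vertex (cellPoint c) (subst (ℕ._≤ 2 ℕ.* n) (sym (twiceNorm-cellPoint c))
    (ℕ.*-monoʳ-≤ 2 (ℕ.⊔-lub (m≤2n⇒∣m-n∣≤n (dp≤ c)) (m≤2n⇒∣m-n∣≤n (ap≤ c)))))
    where
    dp≤ : ∀ c → diagonalPosition c ℕ.≤ 2 ℕ.* n
    dp≤ (inj₁ (i , j)) = evenPosition≤ i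
    dp≤ (inj₂ (k , l)) = ℕ.<⇒≤ (oddPosition< k)
    ap≤ : ∀ c → antidiagonalPosition c ℕ.≤ 2 ℕ.* n
    ap≤ (inj₁ (i , j)) = ℕ.<⇒≤ (oddPosition< j)
    ap≤ (inj₂ (k , l)) = evenPosition≤ l

  vertex-≡ : ∀ {n} {p q : ADVertex n} → point p ≡ point q → p ≡ q
  vertex-≡ {p = vertex p h} {vertex .p h′} refl = cong (vertex p) (ℕ.≤-irrelevant h h′)

  evenPosition-injective : ∀ {n} {i j : Fin (suc n)} → evenPosition i ≡ evenPosition j → i ≡ j
  evenPosition-injective {i = i} {j} eq = Fin.toℕ-injective (ℕ.*-cancelˡ-≡ (toℕ i) (toℕ j) 2 eq)

  oddPosition-injective : ∀ {n} {i j : Fin n} → oddPosition i ≡ oddPosition j → i ≡ j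
  oddPosition-injective {i = i} {j} eq = Fin.toℕ-injective (ℕ.*-cancelˡ-≡ (toℕ i) (toℕ j) 2 (ℕ.suc-injective eq))

  positions-injective : ∀ {n} (c d : Cell n) → diagonalPosition c ≡ diagonalPosition d →
    antidiagonalPosition c ≡ antidiagonalPosition d → c ≡ d
  positions-injective (inj₁ _) (inj₁ _) eq eq′ = cong inj₁ (cong₂ _,_ (evenPosition-injective eq) (oddPosition-injective eq′))
  positions-injective (inj₂ _) (inj₂ _) eq eq′ = cong inj₂ (cong₂ _,_ (oddPosition-injective eq) (evenPosition-injective eq′))
  positions-injective (inj₁ (i , _)) (inj₂ (k , _)) eq _ = contradiction eq (even≢odd (toℕ i) (toℕ k))
  positions-injective (inj₂ (k , _)) (inj₁ (i , _)) eq _ = contradiction (sym eq) (even≢odd (toℕ i) (toℕ k))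

  cellVertex-injective : ∀ {n} (c d : Cell n) → cellVertex c ≡ cellVertex d → c ≡ d
  cellVertex-injective {n} c d eq = positions-injective c d
    (unshift (trans (sym (diagonal-cellPoint c)) (trans (cong (diagonal ∘ point) eq) (diagonal-cellPoint d))))
    (unshift (trans (sym (antidiagonal-cellPoint c)) (trans (cong (antidiagonal ∘ point) eq) (antidiagonal-cellPoint d))))
    where
    unshift : ∀ {x y} → + x ℤ.- + n ≡ + y ℤ.- + n → x ≡ y
    unshift e = ℤ.+-injective (ℤ-Group.∙-cancelʳ (ℤ.- (+ n)) _ _ e)

  position : ∀ {n} s → ∣ s ∣ ℕ.≤ n → ∃[ r ] (s ≡ + r ℤ.- + n) × r ℕ.≤ 2 ℕ.* n
  position {n} (+ m) m≤n = m ℕ.+ n ,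
    ZS.solve 2 (λ m n → m ZS.:= m ZS.:+ n ZS.:- n) refl (+ m) (+ n) ,
    ℕ.+-mono-≤ m≤n (ℕ.m≤m+n n 0)
  position {n} -[1+ m ] m<n = n ℕ.∸ suc m ,
    trans (ZS.solve 2 (λ s n → s ZS.:= (s ZS.:+ n) ZS.:- n) refl -[1+ m ] (+ n)) (cong (ℤ._- + n) (ℤ.⊖-≥ m<n)) ,
    ℕ.≤-trans (ℕ.m∸n≤m n (suc m)) (ℕ.m≤m+n n (n ℕ.+ 0))

  -- The two diagonal coordinates of a half-integral point add up to 2a + 1, and the shift by `n`
  -- changes the sum by the even number 2n.
  diagonals-opposite : ∀ {x y n} p z → diagonal p ≡ x ℤ.- n → antidiagonal p ≡ y ℤ.- n → x ℤ.+ y ≢ + 2 ℤ.* z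
  diagonals-opposite {x} {y} {n} p z eq eq′ x+y≡2z = even≢oddℤ (z ℤ.- n) (proj₁ p) (begin
    + 2 ℤ.* (z ℤ.- n)                ≡⟨ ZS.solve 2 (λ z n → ZS.con (+ 2) ZS.:* (z ZS.:- n)
                                          ZS.:= ZS.con (+ 2) ZS.:* z ZS.:- ZS.con (+ 2) ZS.:* n) refl z n ⟩
    + 2 ℤ.* z ℤ.- + 2 ℤ.* n          ≡⟨ cong (ℤ._- + 2 ℤ.* n) x+y≡2z ⟨
    x ℤ.+ y ℤ.- + 2 ℤ.* n            ≡⟨ ZS.solve 3 (λ x y n → x ZS.:+ y ZS.:- ZS.con (+ 2) ZS.:* n
                                          ZS.:= (x ZS.:- n) ZS.:+ (y ZS.:- n)) refl x y n ⟩
    (x ℤ.- n) ℤ.+ (y ℤ.- n)          ≡⟨ cong₂ ℤ._+_ eq eq′ ⟨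
    diagonal p ℤ.+ antidiagonal p    ≡⟨ double-diagonals p ⟩
    + 2 ℤ.* proj₁ p ℤ.+ + 1          ∎)

  +-evens : ∀ i j → + (2 ℕ.* i) ℤ.+ + (2 ℕ.* j) ≡ + 2 ℤ.* (+ i ℤ.+ + j)
  +-evens i j = trans (cong₂ ℤ._+_ (+-double i) (+-double j)) (sym (ℤ.*-distribˡ-+ (+ 2) (+ i) (+ j)))

  +-odds : ∀ i j → + suc (2 ℕ.* i) ℤ.+ + suc (2 ℕ.* j) ≡ + 2 ℤ.* (+ i ℤ.+ + j ℤ.+ + 1)
  +-odds i j = trans
    (ZS.solve 2 (λ x y → (ZS.con (+ 1) ZS.:+ x) ZS.:+ (ZS.con (+ 1) ZS.:+ y) ZS.:= x ZS.:+ y ZS.:+ ZS.con (+ 2))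
      refl (+ (2 ℕ.* i)) (+ (2 ℕ.* j)))
    (trans (cong (ℤ._+ + 2) (+-evens i j)) (sym (ℤ.*-distribˡ-+ (+ 2) (+ i ℤ.+ + j) (+ 1))))

  module _ {n : ℕ} where

    even< : ∀ k → 2 ℕ.* k ℕ.≤ 2 ℕ.* n → k ℕ.< suc n
    even< k = s≤s ∘ ℕ.*-cancelˡ-≤ {k} {n} 2

    odd< : ∀ k → suc (2 ℕ.* k) ℕ.≤ 2 ℕ.* n → k ℕ.< n
    odd< k = ℕ.*-cancelˡ-< 2 k n

    locate : ∀ {r r′} → Parity r → Parity r′ → r ℕ.≤ 2 ℕ.* n → r′ ℕ.≤ 2 ℕ.* n →
      (∃[ c ] diagonalPosition {n} c ≡ r × antidiagonalPosition c ≡ r′) ⊎ (∃[ z ] + r ℤ.+ + r′ ≡ + 2 ℤ.* z)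
    locate (even i) (odd j) r≤ r′≤ = inj₁ (inj₁ (fromℕ< (even< i r≤) , fromℕ< (odd< j r′≤)) ,
      cong (2 ℕ.*_) (Fin.toℕ-fromℕ< (even< i r≤)) , cong (λ z → suc (2 ℕ.* z)) (Fin.toℕ-fromℕ< (odd< j r′≤)))
    locate (odd k) (even l) r≤ r′≤ = inj₁ (inj₂ (fromℕ< (odd< k r≤) , fromℕ< (even< l r′≤)) ,
      cong (λ z → suc (2 ℕ.* z)) (Fin.toℕ-fromℕ< (odd< k r≤)) , cong (2 ℕ.*_) (Fin.toℕ-fromℕ< (even< l r′≤)))
    locate (even i) (even j) _ _ = inj₂ (+ i ℤ.+ + j , +-evens i j)
    locate (odd i)  (odd j)  _ _ = inj₂ (+ i ℤ.+ + j ℤ.+ + 1 , +-odds i j)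

    cellVertex-surjective : (p : ADVertex n) → ∃[ c ] cellVertex c ≡ p
    cellVertex-surjective (vertex p h)
      with h′ ← ℕ.*-cancelˡ-≤ {∣ diagonal p ∣ ⊔ ∣ antidiagonal p ∣} {n} 2 (subst (ℕ._≤ 2 ℕ.* n) (twiceNorm≡ p) h)
      with r , eq , r≤ ← position {n} (diagonal p) (ℕ.m⊔n≤o⇒m≤o ∣ diagonal p ∣ ∣ antidiagonal p ∣ h′)
         | r′ , eq′ , r′≤ ← position {n} (antidiagonal p) (ℕ.m⊔n≤o⇒n≤o ∣ diagonal p ∣ ∣ antidiagonal p ∣ h′)
      with locate (parity r) (parity r′) r≤ r′≤
    ... | inj₁ (c , refl , refl) = c , vertex-≡ (diagonals-injective (cellPoint c) p
      (trans (diagonal-cellPoint c) (sym eq)) (trans (antidiagonal-cellPoint c) (sym eq′)))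
    ... | inj₂ (z , opposite) = ⊥-elim (diagonals-opposite {+ r} {+ r′} {+ n} p z eq eq′ opposite)

Cell↔ADVertex : ∀ {n} → Cell n ↔ ADVertex n
Cell↔ADVertex = mk↔ₛ′ cellVertex (proj₁ ∘ cellVertex-surjective) (proj₂ ∘ cellVertex-surjective)
  (λ c → cellVertex-injective _ c (proj₂ (cellVertex-surjective (cellVertex c))))

ADVertex-finite : ∀ n → Finite (ADVertex n)
ADVertex-finite n = image-finite Cell↔ADVertex (Cell-finite n)

-- Grid weights as products of path weights

indicator₁ : ℕ → ℚ
indicator₁ r = if does (r ℕ.≟ 1) then 1ℚ else 0ℚ

-- This turns adjacency in maximum distance into a product over the two coordinates. Distance 0 in
-- one coordinate would spoil it; between opposite colour classes parity excludes that.
indicator₁-⊔ : ∀ r s → r ≢ 0 → s ≢ 0 → indicator₁ (r ⊔ s) ≡ indicator₁ r * indicator₁ s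
indicator₁-⊔ zero          s             r≢0 s≢0 = contradiction refl r≢0
indicator₁-⊔ (suc r)       zero          r≢0 s≢0 = contradiction refl s≢0
indicator₁-⊔ (suc zero)    (suc zero)    _   _   = refl
indicator₁-⊔ (suc zero)    (suc (suc s)) _   _   = refl
indicator₁-⊔ (suc (suc r)) (suc zero)    _   _   = refl
indicator₁-⊔ (suc (suc r)) (suc (suc s)) _   _   = refl

indicator₁-even : ∀ r → indicator₁ (2 ℕ.* r) ≡ 0ℚ
indicator₁-even r = cong (if_then 1ℚ else 0ℚ) (dec-false (2 ℕ.* r ℕ.≟ 1) (even≢odd r 0))

adjacent≡indicator₁ : ∀ {m} (k : Fin m) (i : Fin (suc m)) →
  adjacent k i ≡ indicator₁ ∣ evenPosition i ⊝ oddPosition k ∣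
adjacent≡indicator₁ zero zero = refl
adjacent≡indicator₁ zero (suc zero) = refl
adjacent≡indicator₁ zero (suc (suc i)) rewrite ℕ.+-suc (toℕ i) (suc (toℕ i ℕ.+ 0)) = refl
adjacent≡indicator₁ (suc k) zero = refl
adjacent≡indicator₁ (suc k) (suc i) = trans (adjacent≡indicator₁ k i)
  (cong indicator₁ (sym (cong₂ (λ u v → ∣ u ⊝ suc v ∣) (ℕ.*-suc 2 (toℕ i)) (ℕ.*-suc 2 (toℕ k)))))

∣even-odd∣≢0 : ∀ i k → ∣ 2 ℕ.* i ⊝ suc (2 ℕ.* k) ∣ ≢ 0
∣even-odd∣≢0 i k eq = even≢odd i k (ℕ.∣m-n∣≡0⇒m≡n eq)

∣even-even∣ : ∀ i j → ∣ 2 ℕ.* i ⊝ 2 ℕ.* j ∣ ≡ 2 ℕ.* ∣ i ⊝ j ∣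
∣even-even∣ i j = sym (ℕ.*-distribˡ-∣-∣ 2 i j)

-- Between the two classes both coordinate distances are odd, so the indicator factorises. Within a
-- class both are even, so their maximum is never 1.
gridWeight-Cell : ∀ {n} (c d : Cell n) →
  gridWeight (cellPoint c) (cellPoint d) ≡ weight (Board (adjacentᵀ {n}) adjacent) c d
gridWeight-Cell c@(inj₁ (i , j)) d@(inj₂ (k , l)) = begin
  gridWeight (cellPoint c) (cellPoint d)
    ≡⟨ gridWeight-cellPoint c d ⟩
  indicator₁ (∣ evenPosition i ⊝ oddPosition k ∣ ⊔ ∣ oddPosition j ⊝ evenPosition l ∣)
    ≡⟨ cong (λ r → indicator₁ (∣ evenPosition i ⊝ oddPosition k ∣ ⊔ r)) (ℕ.∣-∣-comm (oddPosition j) (evenPosition l)) ⟩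
  indicator₁ (∣ evenPosition i ⊝ oddPosition k ∣ ⊔ ∣ evenPosition l ⊝ oddPosition j ∣)
    ≡⟨ indicator₁-⊔ _ _ (∣even-odd∣≢0 (toℕ i) (toℕ k)) (∣even-odd∣≢0 (toℕ l) (toℕ j)) ⟩
  indicator₁ ∣ evenPosition i ⊝ oddPosition k ∣ * indicator₁ ∣ evenPosition l ⊝ oddPosition j ∣
    ≡⟨ cong₂ _*_ (adjacent≡indicator₁ k i) (adjacent≡indicator₁ j l) ⟨
  adjacent k i * adjacent j l ∎
gridWeight-Cell c@(inj₂ (k , l)) d@(inj₁ (i , j)) = begin
  gridWeight (cellPoint c) (cellPoint d)
    ≡⟨ gridWeight-cellPoint c d ⟩
  indicator₁ (∣ oddPosition k ⊝ evenPosition i ∣ ⊔ ∣ evenPosition l ⊝ oddPosition j ∣)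
    ≡⟨ cong (λ r → indicator₁ (r ⊔ ∣ evenPosition l ⊝ oddPosition j ∣)) (ℕ.∣-∣-comm (oddPosition k) (evenPosition i)) ⟩
  indicator₁ (∣ evenPosition i ⊝ oddPosition k ∣ ⊔ ∣ evenPosition l ⊝ oddPosition j ∣)
    ≡⟨ indicator₁-⊔ _ _ (∣even-odd∣≢0 (toℕ i) (toℕ k)) (∣even-odd∣≢0 (toℕ l) (toℕ j)) ⟩
  indicator₁ ∣ evenPosition i ⊝ oddPosition k ∣ * indicator₁ ∣ evenPosition l ⊝ oddPosition j ∣
    ≡⟨ cong₂ _*_ (adjacent≡indicator₁ k i) (adjacent≡indicator₁ j l) ⟨
  adjacent k i * adjacent j l ∎
gridWeight-Cell c@(inj₁ (i , j)) d@(inj₁ (i′ , j′)) = trans (gridWeight-cellPoint c d) (trans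
  (cong indicator₁ (trans (cong₂ _⊔_ (∣even-even∣ (toℕ i) (toℕ i′)) (∣even-even∣ (toℕ j) (toℕ j′))) (sym (ℕ.*-distribˡ-⊔ 2 ∣ toℕ i ⊝ toℕ i′ ∣ ∣ toℕ j ⊝ toℕ j′ ∣))))
  (indicator₁-even (∣ toℕ i ⊝ toℕ i′ ∣ ⊔ ∣ toℕ j ⊝ toℕ j′ ∣)))
gridWeight-Cell c@(inj₂ (i , j)) d@(inj₂ (i′ , j′)) = trans (gridWeight-cellPoint c d) (trans
  (cong indicator₁ (trans (cong₂ _⊔_ (∣even-even∣ (toℕ i) (toℕ i′)) (∣even-even∣ (toℕ j) (toℕ j′))) (sym (ℕ.*-distribˡ-⊔ 2 ∣ toℕ i ⊝ toℕ i′ ∣ ∣ toℕ j ⊝ toℕ j′ ∣))))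
  (indicator₁-even (∣ toℕ i ⊝ toℕ i′ ∣ ⊔ ∣ toℕ j ⊝ toℕ j′ ∣)))

Board≈AD : ∀ n → Board (adjacentᵀ {n}) adjacent ≈ AD n
Board≈AD n = relabel (Cell-finite n) Cell↔ADVertex (λ c d → sym (gridWeight-Cell c d))

-- Boundary of the diamond and end points of the path

boundaryFactor : ∀ {n} → ADVertex n → ℚ
boundaryFactor {n} p = if does (twiceNorm (point p) ℕ.≟ 2 ℕ.* n) then 2ℚ else 1ℚ

-- The quotient of AP n by the exchange of the two copies of AD n.

FoldedAD : ℕ → Graph
FoldedAD n .Vertex     = ADVertex n
FoldedAD n .weight p q = boundaryFactor p * weight (AD n) p q

-- Here `r` is the distance of the odd coordinate from the centre, always less than the radius. So a
-- cell lies on the boundary exactly when its even coordinate is an end point of the path.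
endpointFactor-position : ∀ {m} (i : Fin (suc (suc m))) {r} → r ℕ.< suc m →
  (if does ((∣ evenPosition i ⊝ suc m ∣ ⊔ r) ℕ.≟ suc m) then 2ℚ else 1ℚ) ≡ endpointFactor i
endpointFactor-position {m} zero {r} r<n = cong (if_then 2ℚ else 1ℚ)
  (dec-true (suc m ⊔ r ℕ.≟ suc m) (ℕ.m≥n⇒m⊔n≡m (ℕ.<⇒≤ r<n)))
endpointFactor-position {m} (suc i) {r} r<n = [ isLast , notLast ]′ (lastFactor-view i)
  where
  lastFactor-view : ∀ {m} (i : Fin m) → (suc (toℕ i) ≡ m × lastFactor i ≡ 2ℚ) ⊎ (suc (toℕ i) ℕ.< m × lastFactor i ≡ 1ℚ)
  lastFactor-view {suc zero}    zero = inj₁ (refl , refl)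
  lastFactor-view {suc (suc m)} zero = inj₂ (s≤s (s≤s z≤n) , refl)
  lastFactor-view {suc m} (suc i) with lastFactor-view i
  ... | inj₁ (eq , w) = inj₁ (cong suc eq , w)
  ... | inj₂ (lt , w) = inj₂ (s≤s lt , w)
  goal : Set
  goal = (if does ((∣ evenPosition (suc i) ⊝ suc m ∣ ⊔ r) ℕ.≟ suc m) then 2ℚ else 1ℚ) ≡ lastFactor i
  isLast : suc (toℕ i) ≡ suc m × lastFactor i ≡ 2ℚ → goal
  isLast (eq , w) = trans (cong (if_then 2ℚ else 1ℚ) (dec-true (∣ evenPosition (suc i) ⊝ suc m ∣ ⊔ r ℕ.≟ suc m) (begin
    ∣ 2 ℕ.* suc (toℕ i) ⊝ suc m ∣ ⊔ r   ≡⟨ cong (λ u → ∣ 2 ℕ.* u ⊝ suc m ∣ ⊔ r) eq ⟩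
    ∣ 2 ℕ.* suc m ⊝ suc m ∣ ⊔ r         ≡⟨ cong (_⊔ r) (trans (ℕ.∣-∣-comm (2 ℕ.* suc m) (suc m)) (trans (ℕ.∣m-m+n∣≡n (suc m) (suc m ℕ.+ 0)) (ℕ.+-identityʳ (suc m)))) ⟩
    suc m ⊔ r                           ≡⟨ ℕ.m≥n⇒m⊔n≡m (ℕ.<⇒≤ r<n) ⟩
    suc m                               ∎))) (sym w)
  notLast : suc (toℕ i) ℕ.< suc m × lastFactor i ≡ 1ℚ → goal
  notLast (lt , w) = trans (cong (if_then 2ℚ else 1ℚ) (dec-false (∣ evenPosition (suc i) ⊝ suc m ∣ ⊔ r ℕ.≟ suc m) (ℕ.<⇒≢
    (ℕ.⊔-pres-<m (m<2n⇒∣m-n∣<n (s≤s z≤n) (ℕ.*-monoʳ-< 2 lt)) r<n)))) (sym w)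

boundaryFactor-position : ∀ {n} (p : ADVertex n) r → twiceNorm (point p) ≡ 2 ℕ.* r →
  boundaryFactor p ≡ (if does (r ℕ.≟ n) then 2ℚ else 1ℚ)
boundaryFactor-position {n} p r eq = cong (if_then 2ℚ else 1ℚ) (agree (r ℕ.≟ n))
  where
  agree : (r≟n : Dec (r ≡ n)) → does (twiceNorm (point p) ℕ.≟ 2 ℕ.* n) ≡ does r≟n
  agree (yes r≡n) = dec-true (twiceNorm (point p) ℕ.≟ 2 ℕ.* n) (trans eq (cong (2 ℕ.*_) r≡n))
  agree (no r≢n)  = dec-false (twiceNorm (point p) ℕ.≟ 2 ℕ.* n)
    (λ eq′ → r≢n (ℕ.*-cancelˡ-≡ r n 2 (trans (sym eq) eq′)))

∣odd-n∣<n : ∀ {n} (k : Fin n) → ∣ oddPosition k ⊝ n ∣ ℕ.< n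
∣odd-n∣<n k = m<2n⇒∣m-n∣<n (s≤s z≤n) (oddPosition< k)

boundaryFactor₁ : ∀ {m} (i : Fin (suc (suc m))) (j : Fin (suc m)) →
  boundaryFactor (cellVertex (inj₁ (i , j))) ≡ endpointFactor i
boundaryFactor₁ {m} i j = trans (boundaryFactor-position (cellVertex (inj₁ (i , j))) (∣ evenPosition i ⊝ suc m ∣ ⊔ ∣ oddPosition j ⊝ suc m ∣) (twiceNorm-cellPoint {suc m} (inj₁ (i , j))))
  (endpointFactor-position i (∣odd-n∣<n j))

boundaryFactor₂ : ∀ {m} (k : Fin (suc m)) (l : Fin (suc (suc m))) →
  boundaryFactor (cellVertex (inj₂ (k , l))) ≡ endpointFactor l
boundaryFactor₂ {m} k l = trans (boundaryFactor-position (cellVertex (inj₂ (k , l))) (∣ oddPosition k ⊝ suc m ∣ ⊔ ∣ evenPosition l ⊝ suc m ∣) (twiceNorm-cellPoint {suc m} (inj₂ (k , l))))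
  (trans (cong (λ r → if does (r ℕ.≟ suc m) then 2ℚ else 1ℚ) (ℕ.⊔-comm ∣ oddPosition k ⊝ suc m ∣ ∣ evenPosition l ⊝ suc m ∣))
         (endpointFactor-position l (∣odd-n∣<n k)))

-- Doubling a boundary row amounts to doubling the factor of its even coordinate, the first one for
-- `inj₁` and the second one for `inj₂`.
reflectingBoard≈FoldedAD : ∀ m → Board (reflectingᵀ {suc m}) adjacent ≈ FoldedAD (suc m)
reflectingBoard≈FoldedAD m = relabel (Cell-finite (suc m)) Cell↔ADVertex weight≡
  where
  weight≡ : ∀ c d → weight (Board (reflectingᵀ {suc m}) adjacent) c d ≡ weight (FoldedAD (suc m)) (cellVertex c) (cellVertex d)
  weight≡ c d = trans (factor c d) (cong (boundaryFactor (cellVertex c) *_) (sym (gridWeight-Cell c d)))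
    where
    factor : ∀ c d → weight (Board (reflectingᵀ {suc m}) adjacent) c d ≡
      boundaryFactor (cellVertex c) * weight (Board (adjacentᵀ {suc m}) adjacent) c d
    factor (inj₁ (i , j)) (inj₂ (k , l)) = trans (ℚ.*-assoc (endpointFactor i) (adjacent k i) (adjacent j l))
      (cong (_* (adjacent k i * adjacent j l)) (sym (boundaryFactor₁ i j)))
    factor (inj₂ (k , l)) (inj₁ (i , j)) = trans
      (solve 3 (λ a b c → a :* (b :* c) := b :* (a :* c)) refl (adjacent k i) (endpointFactor l) (adjacent j l))
      (cong (_* (adjacent k i * adjacent j l)) (sym (boundaryFactor₂ k l)))
    factor c@(inj₁ _) (inj₁ _) = sym (ℚ.*-zeroʳ (boundaryFactor (cellVertex c)))
    factor c@(inj₂ _) (inj₂ _) = sym (ℚ.*-zeroʳ (boundaryFactor (cellVertex c)))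

-- Symmetric and antisymmetric functions on the pillowcase

module Folding (m : ℕ) (Fm : Finite (ADVertex m)) (Fn : Finite (ADVertex (suc m))) where

  private
    n = suc m

  interior-≡ : ∀ {s p q lt lt′} → p ≡ q → interior {n} s p lt ≡ interior s q lt′
  interior-≡ {s} {p} refl = cong (interior s p) (ℕ.≤-irrelevant _ _)

  copy : Bool → ADVertex n → APVertex n
  copy s p with twiceNorm (point p) ℕ.≟ 2 ℕ.* n
  ... | yes eq = boundary p eq
  ... | no neq = interior s p (ℕ.≤∧≢⇒< (inside p) neq)

  copy-boundary : ∀ s p eq → copy s p ≡ boundary p eq
  copy-boundary s p eq with twiceNorm (point p) ℕ.≟ 2 ℕ.* n
  ... | yes eq′ = cong (boundary p) (ℕ.≡-irrelevant eq′ eq)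
  ... | no neq  = contradiction eq neq

  copy-interior : ∀ s p lt → copy s p ≡ interior s p lt
  copy-interior s p lt with twiceNorm (point p) ℕ.≟ 2 ℕ.* n
  ... | yes eq = contradiction eq (ℕ.<⇒≢ lt)
  ... | no _   = interior-≡ refl

  underlying-copy : ∀ s p → underlying (copy s p) ≡ p
  underlying-copy s p with twiceNorm (point p) ℕ.≟ 2 ℕ.* n
  ... | yes _ = refl
  ... | no _  = refl

  inCopy-copy : ∀ s p → inCopy s (copy s p) ≡ true
  inCopy-copy s p with twiceNorm (point p) ℕ.≟ 2 ℕ.* n
  inCopy-copy true  p | yes _ = refl
  inCopy-copy false p | yes _ = refl
  inCopy-copy true  p | no _  = refl
  inCopy-copy false p | no _  = refl

  raise-< : ∀ (p : ADVertex m) → twiceNorm (point p) ℕ.< 2 ℕ.* n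
  raise-< p = ℕ.≤-<-trans (inside p) (ℕ.*-monoʳ-< 2 ℕ.≤-refl)

  raise : ADVertex m → ADVertex n
  raise p = vertex (point p) (ℕ.<⇒≤ (raise-< p))

  -- The norm takes even values only.
  lower : (p : ADVertex n) → twiceNorm (point p) ℕ.< 2 ℕ.* n → ADVertex m
  lower p lt = vertex (point p) (subst (ℕ._≤ 2 ℕ.* m) (sym (twiceNorm≡ (point p)))
    (ℕ.*-monoʳ-≤ 2 (ℕ.s≤s⁻¹ (ℕ.*-cancelˡ-< 2 (∣ diagonal (point p) ∣ ⊔ ∣ antidiagonal (point p) ∣) n (subst (ℕ._< 2 ℕ.* n) (twiceNorm≡ (point p)) lt)))))

  raised : Bool → ADVertex m → APVertex n
  raised s p = interior s (raise p) (raise-< p)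

  raised-lower : ∀ s p lt → raised s (lower p lt) ≡ interior s p lt
  raised-lower s p lt = interior-≡ (vertex-≡ refl)

  copy-raise : ∀ s p → copy s (raise p) ≡ raised s p
  copy-raise s p = copy-interior s (raise p) (raise-< p)

  -- The whole copy `s`, boundary included, together with the interior of the other copy. Both
  -- choices of `s` are available, so that a sum can be split to suit either copy.
  APVertex↔ : Bool → APVertex n ↔ (ADVertex m ⊎ ADVertex n)
  APVertex↔ s = mk↔ₛ′ (split s) (join s) (split-join s) (join-split s)
    where
    split : Bool → APVertex n → ADVertex m ⊎ ADVertex n
    split true  (interior true  p lt) = inj₂ p
    split true  (interior false p lt) = inj₁ (lower p lt)
    split false (interior true  p lt) = inj₁ (lower p lt)
    split false (interior false p lt) = inj₂ p
    split _     (boundary p eq)       = inj₂ p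

    join : Bool → ADVertex m ⊎ ADVertex n → APVertex n
    join s (inj₁ p) = raised (not s) p
    join s (inj₂ p) = copy s p

    split-join : ∀ s v → split s (join s v) ≡ v
    split-join true  (inj₁ p) = cong inj₁ (vertex-≡ refl)
    split-join false (inj₁ p) = cong inj₁ (vertex-≡ refl)
    split-join s     (inj₂ p) with twiceNorm (point p) ℕ.≟ 2 ℕ.* n
    split-join true  (inj₂ p) | yes _ = refl
    split-join false (inj₂ p) | yes _ = refl
    split-join true  (inj₂ p) | no _  = refl
    split-join false (inj₂ p) | no _  = refl

    join-split : ∀ s v → join s (split s v) ≡ v
    join-split true  (interior true  p lt) = copy-interior true p lt
    join-split true  (interior false p lt) = raised-lower false p lt
    join-split false (interior true  p lt) = raised-lower true p lt
    join-split false (interior false p lt) = copy-interior false p lt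
    join-split true  (boundary p eq)       = copy-boundary true p eq
    join-split false (boundary p eq)       = copy-boundary false p eq

  APVertex-finite : Finite (APVertex n)
  APVertex-finite = image-finite (↔-sym (APVertex↔ false)) (⊎-finite Fm Fn)

  ∑-APVertex : ∀ s (f : Fun (APVertex n)) →
    ∑ APVertex-finite f ≡ ∑ Fm (f ∘ raised (not s)) + ∑ Fn (f ∘ copy s)
  ∑-APVertex s f = trans
    (sym (∑-reindex (⊎-finite Fm Fn) APVertex-finite (↔-sym (APVertex↔ s)) f))
    (∑-⊎ Fm Fn (f ∘ from (APVertex↔ s)))

  -- Both sides are sums over AP n of the function that is g on the interior of
  -- the first copy and 0 elsewhere.
  ∑-interior : ∀ (g : Fun (ADVertex n)) → (∀ p → twiceNorm (point p) ≡ 2 ℕ.* n → g p ≡ 0ℚ) →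
    ∑ Fn g ≡ ∑ Fm (g ∘ raise)
  ∑-interior g g≡0 = begin
    ∑ Fn g                                     ≡⟨ ℓ-cong (∑-linear Fn) onTrue ⟨
    ∑ Fn (g′ ∘ copy true)                      ≡⟨ ℚ.+-identityˡ _ ⟨
    0ℚ + ∑ Fn (g′ ∘ copy true)                 ≡⟨ cong (_+ ∑ Fn (g′ ∘ copy true)) (ℓ-zero (∑-linear Fm) (λ _ → refl)) ⟨
    ∑ Fm (g′ ∘ raised false) + ∑ Fn (g′ ∘ copy true)  ≡⟨ ∑-APVertex true g′ ⟨
    ∑ APVertex-finite g′                       ≡⟨ ∑-APVertex false g′ ⟩
    ∑ Fm (g ∘ raise) + ∑ Fn (g′ ∘ copy false)  ≡⟨ cong (∑ Fm (g ∘ raise) +_) (ℓ-zero (∑-linear Fn) onFalse) ⟩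
    ∑ Fm (g ∘ raise) + 0ℚ                      ≡⟨ ℚ.+-identityʳ _ ⟩
    ∑ Fm (g ∘ raise)                           ∎
    where
    g′ : Fun (APVertex n)
    g′ (interior true  p _) = g p
    g′ (interior false _ _) = 0ℚ
    g′ (boundary _ _)       = 0ℚ
    onTrue : g′ ∘ copy true ≗ g
    onTrue p with twiceNorm (point p) ℕ.≟ 2 ℕ.* n
    ... | yes eq = sym (g≡0 p eq)
    ... | no _   = refl
    onFalse : ∀ p → g′ (copy false p) ≡ 0ℚ
    onFalse p with twiceNorm (point p) ℕ.≟ 2 ℕ.* n
    ... | yes _ = refl
    ... | no _  = refl

  inCopy-raised-not : ∀ s p → inCopy s (raised (not s) p) ≡ false
  inCopy-raised-not true  p = refl
  inCopy-raised-not false p = refl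

  -- When the sum is split with copy `s` whole, the interior of the other copy carries no edges of
  -- copy `s`, and only a sum over `AD n` survives.
  ∑-copyWeight : ∀ s (f : Fun (APVertex n)) u → ∑ APVertex-finite (λ v → copyWeight s u v * f v) ≡
    (if inCopy s u then operator (AD n) Fn (f ∘ copy s) (underlying u) else 0ℚ)
  ∑-copyWeight s f u = begin
    ∑ APVertex-finite (λ v → copyWeight s u v * f v)
      ≡⟨ ∑-APVertex s (λ v → copyWeight s u v * f v) ⟩
    ∑ Fm (λ p → copyWeight s u (raised (not s) p) * f (raised (not s) p)) + t
      ≡⟨ cong (_+ t) (ℓ-zero (∑-linear Fm) otherCopy) ⟩
    0ℚ + t
      ≡⟨ ℚ.+-identityˡ t ⟩
    t
      ≡⟨ ℓ-cong (∑-linear Fn) (λ p → cong (_* f (copy s p)) (sameCopy p)) ⟩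
    ∑ Fn (λ p → (if inCopy s u then weight (AD n) (underlying u) p else 0ℚ) * f (copy s p))
      ≡⟨ extract (inCopy s u) ⟩
    (if inCopy s u then operator (AD n) Fn (f ∘ copy s) (underlying u) else 0ℚ) ∎
    where
    t = ∑ Fn (λ p → copyWeight s u (copy s p) * f (copy s p))
    otherCopy : ∀ p → copyWeight s u (raised (not s) p) * f (raised (not s) p) ≡ 0ℚ
    otherCopy p rewrite inCopy-raised-not s p with inCopy s u
    ... | true  = ℚ.*-zeroˡ (f (raised (not s) p))
    ... | false = ℚ.*-zeroˡ (f (raised (not s) p))
    sameCopy : ∀ p → copyWeight s u (copy s p) ≡ (if inCopy s u then weight (AD n) (underlying u) p else 0ℚ)
    sameCopy p rewrite inCopy-copy s p | underlying-copy s p with inCopy s u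
    ... | true  = refl
    ... | false = refl
    extract : ∀ b → ∑ Fn (λ p → (if b then weight (AD n) (underlying u) p else 0ℚ) * f (copy s p)) ≡
      (if b then operator (AD n) Fn (f ∘ copy s) (underlying u) else 0ℚ)
    extract true  = refl
    extract false = ℓ-zero (∑-linear Fn) (λ p → ℚ.*-zeroˡ (f (copy s p)))

  operator-AP : ∀ f u → operator (AP n) APVertex-finite f u ≡
    (if inCopy true u then operator (AD n) Fn (f ∘ copy true) (underlying u) else 0ℚ) +
    (if inCopy false u then operator (AD n) Fn (f ∘ copy false) (underlying u) else 0ℚ)
  operator-AP f u = begin
    ∑ APVertex-finite (λ v → (copyWeight true u v + copyWeight false u v) * f v)
      ≡⟨ ℓ-cong (∑-linear APVertex-finite) (λ v → ℚ.*-distribʳ-+ (f v) (copyWeight true u v) (copyWeight false u v)) ⟩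
    ∑ APVertex-finite (λ v → copyWeight true u v * f v + copyWeight false u v * f v)
      ≡⟨ additive (∑-linear APVertex-finite) (λ v → copyWeight true u v * f v) (λ v → copyWeight false u v * f v) ⟩
    ∑ APVertex-finite (λ v → copyWeight true u v * f v) + ∑ APVertex-finite (λ v → copyWeight false u v * f v)
      ≡⟨ cong₂ _+_ (∑-copyWeight true f u) (∑-copyWeight false f u) ⟩
    _ ∎

  operator-AP-interior : ∀ f s p lt →
    operator (AP n) APVertex-finite f (interior s p lt) ≡ operator (AD n) Fn (f ∘ copy s) p
  operator-AP-interior f true  p lt = trans (operator-AP f (interior true p lt)) (ℚ.+-identityʳ _)
  operator-AP-interior f false p lt = trans (operator-AP f (interior false p lt)) (ℚ.+-identityˡ _)

  fold : Fun (APVertex n) → Fun (ADVertex m ⊎ ADVertex n)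
  fold f (inj₁ p) = f (raised true p) - f (raised false p)
  fold f (inj₂ p) = f (copy true p) + f (copy false p)

  fold-injective : ∀ {f} → (∀ v → fold f v ≡ 0ℚ) → ∀ u → f u ≡ 0ℚ
  fold-injective {f} p (boundary q eq) = proj₁ (half-cancel
    (trans (sym (cong₂ (λ u v → f u + f v) (copy-boundary true q eq) (copy-boundary false q eq))) (p (inj₂ q)))
    (ℚ.+-inverseʳ (f (boundary q eq))))
  fold-injective {f} p (interior s q lt) = choose s
    where
    both = half-cancel
      (trans (sym (cong₂ (λ u v → f u + f v) (copy-interior true q lt) (copy-interior false q lt))) (p (inj₂ q)))
      (trans (sym (cong₂ (λ u v → f u - f v) (raised-lower true q lt) (raised-lower false q lt))) (p (inj₁ (lower q lt))))
    choose : ∀ s → f (interior s q lt) ≡ 0ℚ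
    choose true  = proj₁ both
    choose false = proj₂ both

  fold-surjective : ∀ g → ∃[ f ] fold f ≗ g
  fold-surjective g = f , λ { (inj₁ p) → onDifference p ; (inj₂ p) → onSum p }
    where
    f : Fun (APVertex n)
    f (interior true  p lt) = ½ * (g (inj₂ p) + g (inj₁ (lower p lt)))
    f (interior false p lt) = ½ * (g (inj₂ p) - g (inj₁ (lower p lt)))
    -- On the boundary the two copies coincide, so `fold` doubles the value.
    f (boundary p _)        = ½ * g (inj₂ p)
    onDifference : ∀ p → fold f (inj₁ p) ≡ g (inj₁ p)
    onDifference p = trans
      (solve 2 (λ a b → con ½ :* (a :+ b) :- con ½ :* (a :- b) := b) refl (g (inj₂ (raise p))) (g (inj₁ (lower (raise p) (raise-< p)))))
      (cong (g ∘ inj₁) (vertex-≡ refl))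
    onSum : ∀ p → fold f (inj₂ p) ≡ g (inj₂ p)
    onSum p with twiceNorm (point p) ℕ.≟ 2 ℕ.* n
    ... | yes _ = solve 1 (λ a → con ½ :* a :+ con ½ :* a := a) refl (g (inj₂ p))
    ... | no _  = solve 2 (λ a b → con ½ :* (a :+ b) :+ con ½ :* (a :- b) := a) refl (g (inj₂ p)) _

  -- The difference `d` of the two copies makes sense on all of `AD n` and vanishes on the boundary,
  -- so restricting the sum to the interior loses nothing.
  fold-commutes₁ : ∀ f p → operator (AD m) Fm (fold f ∘ inj₁) p ≡ fold (operator (AP n) APVertex-finite f) (inj₁ p)
  fold-commutes₁ f p = begin
    ∑ Fm (λ q → weight (AD m) p q * (f (raised true q) - f (raised false q)))
      ≡⟨ ℓ-cong (∑-linear Fm) (λ q → cong (weight (AD m) p q *_) (cong₂ (λ u v → f u - f v) (copy-raise true q) (copy-raise false q))) ⟨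
    ∑ Fm (λ q → weight (AD n) (raise p) (raise q) * d (raise q))
      ≡⟨ ∑-interior (λ q → weight (AD n) (raise p) q * d q) (λ q eq → trans (cong (weight (AD n) (raise p) q *_) (d≡0 q eq)) (ℚ.*-zeroʳ (weight (AD n) (raise p) q))) ⟨
    operator (AD n) Fn d (raise p)
      ≡⟨ ℓ-diff (apply-linear Fn (weight (AD n)) (raise p)) (f ∘ copy true) (f ∘ copy false) ⟩
    operator (AD n) Fn (f ∘ copy true) (raise p) - operator (AD n) Fn (f ∘ copy false) (raise p)
      ≡⟨ cong₂ _-_ (operator-AP-interior f true (raise p) (raise-< p)) (operator-AP-interior f false (raise p) (raise-< p)) ⟨
    fold (operator (AP n) APVertex-finite f) (inj₁ p) ∎
    where
    d : Fun (ADVertex n)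
    d q = f (copy true q) - f (copy false q)
    d≡0 : ∀ q → twiceNorm (point q) ≡ 2 ℕ.* n → d q ≡ 0ℚ
    d≡0 q eq = trans (cong₂ (λ u v → f u - f v) (copy-boundary true q eq) (copy-boundary false q eq)) (ℚ.+-inverseʳ (f (boundary q eq)))

  -- An interior vertex sees only its own copy, and the two contributions add to `a + b`. A boundary
  -- vertex sees both copies and is itself counted twice by `fold`, which gives the factor 2.
  fold-commutes₂ : ∀ f p → operator (FoldedAD n) Fn (fold f ∘ inj₂) p ≡ fold (operator (AP n) APVertex-finite f) (inj₂ p)
  fold-commutes₂ f p = begin
    ∑ Fn (λ q → boundaryFactor p * weight (AD n) p q * fold f (inj₂ q))
      ≡⟨ ℓ-cong (∑-linear Fn) (λ q → ℚ.*-assoc (boundaryFactor p) (weight (AD n) p q) (fold f (inj₂ q))) ⟩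
    ∑ Fn (λ q → boundaryFactor p * (weight (AD n) p q * fold f (inj₂ q)))
      ≡⟨ homogeneous (∑-linear Fn) (boundaryFactor p) (λ q → weight (AD n) p q * fold f (inj₂ q)) ⟩
    boundaryFactor p * operator (AD n) Fn (fold f ∘ inj₂) p
      ≡⟨ cong (boundaryFactor p *_) (additive (apply-linear Fn (weight (AD n)) p) (f ∘ copy true) (f ∘ copy false)) ⟩
    boundaryFactor p * (operator (AD n) Fn (f ∘ copy true) p + operator (AD n) Fn (f ∘ copy false) p)
      ≡⟨ copies ⟨
    fold (operator (AP n) APVertex-finite f) (inj₂ p) ∎
    where
    A = operator (AP n) APVertex-finite f
    a = operator (AD n) Fn (f ∘ copy true) p
    b = operator (AD n) Fn (f ∘ copy false) p
    onBoundary : ∀ eq → A (boundary p eq) + A (boundary p eq) ≡ boundaryFactor p * (a + b)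
    onBoundary eq = begin
      A (boundary p eq) + A (boundary p eq)   ≡⟨ cong₂ _+_ (operator-AP f (boundary p eq)) (operator-AP f (boundary p eq)) ⟩
      (a + b) + (a + b)                       ≡⟨ solve 2 (λ a b → (a :+ b) :+ (a :+ b) := con 2ℚ :* (a :+ b)) refl a b ⟩
      2ℚ * (a + b)                            ≡⟨ cong (λ c → (if c then 2ℚ else 1ℚ) * (a + b)) (dec-true (twiceNorm (point p) ℕ.≟ 2 ℕ.* n) eq) ⟨
      boundaryFactor p * (a + b)              ∎
    onInterior : ∀ lt → A (interior true p lt) + A (interior false p lt) ≡ boundaryFactor p * (a + b)
    onInterior lt = begin
      A (interior true p lt) + A (interior false p lt)  ≡⟨ cong₂ _+_ (operator-AP-interior f true p lt) (operator-AP-interior f false p lt) ⟩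
      a + b                                   ≡⟨ ℚ.*-identityˡ (a + b) ⟨
      1ℚ * (a + b)                            ≡⟨ cong (λ c → (if c then 2ℚ else 1ℚ) * (a + b))
                                                   (dec-false (twiceNorm (point p) ℕ.≟ 2 ℕ.* n) (ℕ.<⇒≢ lt)) ⟨
      boundaryFactor p * (a + b)              ∎
    copies : A (copy true p) + A (copy false p) ≡ boundaryFactor p * (a + b)
    copies with twiceNorm (point p) ℕ.≟ 2 ℕ.* n
    ... | yes eq = onBoundary eq
    ... | no neq = onInterior (ℕ.≤∧≢⇒< (inside p) neq)

  AP≈AD⊍FoldedAD : AP n ≈ AD m ⊍ FoldedAD n
  AP≈AD⊍FoldedAD = record
    { finiteˡ = APVertex-finite
    ; finiteʳ = ⊎-finite Fm Fn
    ; bijection = APVertex↔ false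
    ; map = fold
    ; isIso = record
      { linear = λ { (inj₁ p) → +-linear (eval-linear (raised true p)) (-‿linear (eval-linear (raised false p)))
                   ; (inj₂ p) → +-linear (eval-linear (copy true p)) (eval-linear (copy false p)) }
      ; injective = fold-injective
      ; surjective = fold-surjective
      }
    ; commutes = λ f →
      λ { (inj₁ p) → trans (operator-⊍ˡ (AD m) (FoldedAD n) Fm Fn (fold f) p) (fold-commutes₁ f p)
        ; (inj₂ p) → trans (operator-⊍ʳ (AD m) (FoldedAD n) Fm Fn (fold f) p) (fold-commutes₂ f p) }
    }

-- Decomposition of the folded diamond

BipartitePath : {I J : Set} → (I → J → ℚ) → (J → I → ℚ) → Graph
BipartitePath {I} {J} x y .Vertex = I ⊎ J
BipartitePath x y .weight (inj₁ i) (inj₂ k) = 2ℚ * x i k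
BipartitePath x y .weight (inj₂ k) (inj₁ i) = 2ℚ * y k i
BipartitePath x y .weight (inj₁ _) (inj₁ _) = 0ℚ
BipartitePath x y .weight (inj₂ _) (inj₂ _) = 0ℚ

Swap : ℚ → Graph
Swap c .Vertex = ⊤ ⊎ ⊤
Swap c .weight (inj₁ _) (inj₂ _) = c
Swap c .weight (inj₂ _) (inj₁ _) = c
Swap c .weight (inj₁ _) (inj₁ _) = 0ℚ
Swap c .weight (inj₂ _) (inj₂ _) = 0ℚ

module _ {I J : Set} (x : I → J → ℚ) (y : J → I → ℚ) where

  private
    Parts : Graph
    Parts = Board x y ⊍ BipartitePath x y ⊍ BipartitePath x y ⊍ Swap 4ℚ

    Augmented : Graph
    Augmented = Board (augment x) (augment y)

  -- A coordinate at `nothing` stays there under a step and contributes the factor 2. If it is the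
  -- first coordinate, the place on the path is read off the second one, whose class is the
  -- opposite; hence `inj₁` and `inj₂` change places there.
  augmentedBoard-vertices : Vertex Augmented ↔ Vertex Parts
  augmentedBoard-vertices = mk↔ₛ′
    (λ { (inj₁ (just i  , just j))  → inj₁ (inj₁ (i , j))
       ; (inj₂ (just k  , just l))  → inj₁ (inj₂ (k , l))
       ; (inj₁ (just i  , nothing)) → inj₂ (inj₁ (inj₁ i))
       ; (inj₂ (just k  , nothing)) → inj₂ (inj₁ (inj₂ k))
       ; (inj₁ (nothing , just j))  → inj₂ (inj₂ (inj₁ (inj₂ j)))
       ; (inj₂ (nothing , just l))  → inj₂ (inj₂ (inj₁ (inj₁ l)))
       ; (inj₁ (nothing , nothing)) → inj₂ (inj₂ (inj₂ (inj₁ tt)))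
       ; (inj₂ (nothing , nothing)) → inj₂ (inj₂ (inj₂ (inj₂ tt))) })
    (λ { (inj₁ (inj₁ (i , j)))          → inj₁ (just i , just j)
       ; (inj₁ (inj₂ (k , l)))          → inj₂ (just k , just l)
       ; (inj₂ (inj₁ (inj₁ i)))         → inj₁ (just i , nothing)
       ; (inj₂ (inj₁ (inj₂ k)))         → inj₂ (just k , nothing)
       ; (inj₂ (inj₂ (inj₁ (inj₂ j))))  → inj₁ (nothing , just j)
       ; (inj₂ (inj₂ (inj₁ (inj₁ l))))  → inj₂ (nothing , just l)
       ; (inj₂ (inj₂ (inj₂ (inj₁ tt)))) → inj₁ (nothing , nothing)
       ; (inj₂ (inj₂ (inj₂ (inj₂ tt)))) → inj₂ (nothing , nothing) })
    (λ { (inj₁ (inj₁ _))                → refl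
       ; (inj₁ (inj₂ _))                → refl
       ; (inj₂ (inj₁ (inj₁ _)))         → refl
       ; (inj₂ (inj₁ (inj₂ _)))         → refl
       ; (inj₂ (inj₂ (inj₁ (inj₂ _))))  → refl
       ; (inj₂ (inj₂ (inj₁ (inj₁ _))))  → refl
       ; (inj₂ (inj₂ (inj₂ (inj₁ _))))  → refl
       ; (inj₂ (inj₂ (inj₂ (inj₂ _))))  → refl })
    (λ { (inj₁ (just _  , just _))  → refl
       ; (inj₂ (just _  , just _))  → refl
       ; (inj₁ (just _  , nothing)) → refl
       ; (inj₂ (just _  , nothing)) → refl
       ; (inj₁ (nothing , just _))  → refl
       ; (inj₂ (nothing , just _))  → refl
       ; (inj₁ (nothing , nothing)) → refl
       ; (inj₂ (nothing , nothing)) → refl })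

  augmentedBoard-weight : ∀ u v → weight Augmented u v ≡
    weight Parts (to augmentedBoard-vertices u) (to augmentedBoard-vertices v)
  augmentedBoard-weight (inj₁ (just _  , just _))  (inj₂ (just _  , just _))  = refl
  augmentedBoard-weight (inj₁ (just i  , just _))  (inj₂ (just k  , nothing)) = ℚ.*-zeroʳ (x i k)
  augmentedBoard-weight (inj₁ (just _  , just j))  (inj₂ (nothing , just l))  = ℚ.*-zeroˡ (y j l)
  augmentedBoard-weight (inj₁ (just _  , just _))  (inj₂ (nothing , nothing)) = refl
  augmentedBoard-weight (inj₁ (just i  , nothing)) (inj₂ (just k  , just _))  = ℚ.*-zeroʳ (x i k)
  augmentedBoard-weight (inj₁ (just i  , nothing)) (inj₂ (just k  , nothing)) = ℚ.*-comm (x i k) 2ℚ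
  augmentedBoard-weight (inj₁ (just _  , nothing)) (inj₂ (nothing , just _))  = refl
  augmentedBoard-weight (inj₁ (just _  , nothing)) (inj₂ (nothing , nothing)) = refl
  augmentedBoard-weight (inj₁ (nothing , just j))  (inj₂ (just _  , just l))  = ℚ.*-zeroˡ (y j l)
  augmentedBoard-weight (inj₁ (nothing , just _))  (inj₂ (just _  , nothing)) = refl
  augmentedBoard-weight (inj₁ (nothing , just _))  (inj₂ (nothing , just _))  = refl
  augmentedBoard-weight (inj₁ (nothing , just _))  (inj₂ (nothing , nothing)) = refl
  augmentedBoard-weight (inj₁ (nothing , nothing)) (inj₂ (just _  , just _))  = refl
  augmentedBoard-weight (inj₁ (nothing , nothing)) (inj₂ (just _  , nothing)) = refl
  augmentedBoard-weight (inj₁ (nothing , nothing)) (inj₂ (nothing , just _))  = refl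
  augmentedBoard-weight (inj₁ (nothing , nothing)) (inj₂ (nothing , nothing)) = refl
  augmentedBoard-weight (inj₂ (just _  , just _))  (inj₁ (just _  , just _))  = refl
  augmentedBoard-weight (inj₂ (just k  , just _))  (inj₁ (just i  , nothing)) = ℚ.*-zeroʳ (y k i)
  augmentedBoard-weight (inj₂ (just _  , just l))  (inj₁ (nothing , just j))  = ℚ.*-zeroˡ (x l j)
  augmentedBoard-weight (inj₂ (just _  , just _))  (inj₁ (nothing , nothing)) = refl
  augmentedBoard-weight (inj₂ (just k  , nothing)) (inj₁ (just i  , just _))  = ℚ.*-zeroʳ (y k i)
  augmentedBoard-weight (inj₂ (just k  , nothing)) (inj₁ (just i  , nothing)) = ℚ.*-comm (y k i) 2ℚ
  augmentedBoard-weight (inj₂ (just _  , nothing)) (inj₁ (nothing , just _))  = refl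
  augmentedBoard-weight (inj₂ (just _  , nothing)) (inj₁ (nothing , nothing)) = refl
  augmentedBoard-weight (inj₂ (nothing , just l))  (inj₁ (just _  , just j))  = ℚ.*-zeroˡ (x l j)
  augmentedBoard-weight (inj₂ (nothing , just _))  (inj₁ (just _  , nothing)) = refl
  augmentedBoard-weight (inj₂ (nothing , just _))  (inj₁ (nothing , just _))  = refl
  augmentedBoard-weight (inj₂ (nothing , just _))  (inj₁ (nothing , nothing)) = refl
  augmentedBoard-weight (inj₂ (nothing , nothing)) (inj₁ (just _  , just _))  = refl
  augmentedBoard-weight (inj₂ (nothing , nothing)) (inj₁ (just _  , nothing)) = refl
  augmentedBoard-weight (inj₂ (nothing , nothing)) (inj₁ (nothing , just _))  = refl
  augmentedBoard-weight (inj₂ (nothing , nothing)) (inj₁ (nothing , nothing)) = refl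
  augmentedBoard-weight (inj₁ (just _  , just _))  (inj₁ (just _  , just _))  = refl
  augmentedBoard-weight (inj₁ (just _  , just _))  (inj₁ (just _  , nothing)) = refl
  augmentedBoard-weight (inj₁ (just _  , just _))  (inj₁ (nothing , just _))  = refl
  augmentedBoard-weight (inj₁ (just _  , just _))  (inj₁ (nothing , nothing)) = refl
  augmentedBoard-weight (inj₁ (just _  , nothing)) (inj₁ (just _  , just _))  = refl
  augmentedBoard-weight (inj₁ (just _  , nothing)) (inj₁ (just _  , nothing)) = refl
  augmentedBoard-weight (inj₁ (just _  , nothing)) (inj₁ (nothing , just _))  = refl
  augmentedBoard-weight (inj₁ (just _  , nothing)) (inj₁ (nothing , nothing)) = refl
  augmentedBoard-weight (inj₁ (nothing , just _))  (inj₁ (just _  , just _))  = refl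
  augmentedBoard-weight (inj₁ (nothing , just _))  (inj₁ (just _  , nothing)) = refl
  augmentedBoard-weight (inj₁ (nothing , just _))  (inj₁ (nothing , just _))  = refl
  augmentedBoard-weight (inj₁ (nothing , just _))  (inj₁ (nothing , nothing)) = refl
  augmentedBoard-weight (inj₁ (nothing , nothing)) (inj₁ (just _  , just _))  = refl
  augmentedBoard-weight (inj₁ (nothing , nothing)) (inj₁ (just _  , nothing)) = refl
  augmentedBoard-weight (inj₁ (nothing , nothing)) (inj₁ (nothing , just _))  = refl
  augmentedBoard-weight (inj₁ (nothing , nothing)) (inj₁ (nothing , nothing)) = refl
  augmentedBoard-weight (inj₂ (just _  , just _))  (inj₂ (just _  , just _))  = refl
  augmentedBoard-weight (inj₂ (just _  , just _))  (inj₂ (just _  , nothing)) = refl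
  augmentedBoard-weight (inj₂ (just _  , just _))  (inj₂ (nothing , just _))  = refl
  augmentedBoard-weight (inj₂ (just _  , just _))  (inj₂ (nothing , nothing)) = refl
  augmentedBoard-weight (inj₂ (just _  , nothing)) (inj₂ (just _  , just _))  = refl
  augmentedBoard-weight (inj₂ (just _  , nothing)) (inj₂ (just _  , nothing)) = refl
  augmentedBoard-weight (inj₂ (just _  , nothing)) (inj₂ (nothing , just _))  = refl
  augmentedBoard-weight (inj₂ (just _  , nothing)) (inj₂ (nothing , nothing)) = refl
  augmentedBoard-weight (inj₂ (nothing , just _))  (inj₂ (just _  , just _))  = refl
  augmentedBoard-weight (inj₂ (nothing , just _))  (inj₂ (just _  , nothing)) = refl
  augmentedBoard-weight (inj₂ (nothing , just _))  (inj₂ (nothing , just _))  = refl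
  augmentedBoard-weight (inj₂ (nothing , just _))  (inj₂ (nothing , nothing)) = refl
  augmentedBoard-weight (inj₂ (nothing , nothing)) (inj₂ (just _  , just _))  = refl
  augmentedBoard-weight (inj₂ (nothing , nothing)) (inj₂ (just _  , nothing)) = refl
  augmentedBoard-weight (inj₂ (nothing , nothing)) (inj₂ (nothing , just _))  = refl
  augmentedBoard-weight (inj₂ (nothing , nothing)) (inj₂ (nothing , nothing)) = refl

  augmentedBoard≈Parts : Finite I → Finite J →
    Augmented ≈ Board x y ⊍ BipartitePath x y ⊍ BipartitePath x y ⊍ Swap 4ℚ
  augmentedBoard≈Parts FI FJ = relabel (Board-finite (Maybe-finite FI) (Maybe-finite FJ))
    augmentedBoard-vertices augmentedBoard-weight

-- The path assembled from its even and odd points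

path-weight : ∀ q r → (if does (r ℕ.≟ 1) then q else 0ℚ) ≡ q * indicator₁ r
path-weight q r with does (r ℕ.≟ 1)
... | true  = sym (ℚ.*-identityʳ q)
... | false = sym (ℚ.*-zeroʳ q)

-- The length 2m + 1 is written in the form to which pred (2 * suc m) reduces.

pathLength : ℕ → ℕ
pathLength m = ℕ.pred (2 ℕ.* suc m)

pathLength≡ : ∀ m → pathLength m ≡ suc (2 ℕ.* m)
pathLength≡ m = ℕ.+-suc m (m ℕ.+ 0)

module _ {m : ℕ} where

  private
    pathPosition : Fin (suc m) ⊎ Fin m → ℕ
    pathPosition (inj₁ i) = evenPosition i
    pathPosition (inj₂ k) = oddPosition k

    pathPosition< : ∀ v → pathPosition v ℕ.< pathLength m
    pathPosition< (inj₁ i) = subst (evenPosition i ℕ.<_) (sym (pathLength≡ m)) (s≤s (evenPosition≤ i))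
    pathPosition< (inj₂ k) = subst (oddPosition k ℕ.<_) (sym (pathLength≡ m)) (ℕ.<-trans (oddPosition< k) ℕ.≤-refl)

    interleave : Fin (suc m) ⊎ Fin m → Fin (pathLength m)
    interleave v = fromℕ< (pathPosition< v)

    toℕ-interleave : ∀ v → toℕ (interleave v) ≡ pathPosition v
    toℕ-interleave v = Fin.toℕ-fromℕ< (pathPosition< v)

    pathPosition-injective : ∀ u v → pathPosition u ≡ pathPosition v → u ≡ v
    pathPosition-injective (inj₁ _) (inj₁ _) eq = cong inj₁ (evenPosition-injective eq)
    pathPosition-injective (inj₂ _) (inj₂ _) eq = cong inj₂ (oddPosition-injective eq)
    pathPosition-injective (inj₁ i) (inj₂ k) eq = contradiction eq (even≢odd (toℕ i) (toℕ k))
    pathPosition-injective (inj₂ k) (inj₁ i) eq = contradiction (sym eq) (even≢odd (toℕ i) (toℕ k))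

    interleave-injective : ∀ u v → interleave u ≡ interleave v → u ≡ v
    interleave-injective u v eq = pathPosition-injective u v
      (trans (sym (toℕ-interleave u)) (trans (cong toℕ eq) (toℕ-interleave v)))

    pathPosition-surjective : ∀ {r} → Parity r → r ≤ 2 ℕ.* m → ∃[ v ] pathPosition v ≡ r
    pathPosition-surjective (even i) r≤ = inj₁ (fromℕ< (even< i r≤)) , cong (2 ℕ.*_) (Fin.toℕ-fromℕ< (even< i r≤))
    pathPosition-surjective (odd k)  r≤ = inj₂ (fromℕ< (odd< k r≤)) , cong (λ z → suc (2 ℕ.* z)) (Fin.toℕ-fromℕ< (odd< k r≤))

    interleave-surjective : ∀ r → ∃[ v ] interleave v ≡ r
    interleave-surjective r =
      let v , eq = pathPosition-surjective (parity (toℕ r)) (ℕ.s≤s⁻¹ (subst (toℕ r ℕ.<_) (pathLength≡ m) (Fin.toℕ<n r)))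
      in v , Fin.toℕ-injective (trans (toℕ-interleave v) eq)

  interleave↔ : (Fin (suc m) ⊎ Fin m) ↔ Fin (pathLength m)
  interleave↔ = mk↔ₛ′ interleave (proj₁ ∘ interleave-surjective) (proj₂ ∘ interleave-surjective)
    (λ v → interleave-injective _ v (proj₂ (interleave-surjective (interleave v))))

  interleave-weight : ∀ u v → weight (BipartitePath (adjacentᵀ {m}) adjacent) u v ≡
    weight (Path 2ℚ (pathLength m)) (interleave u) (interleave v)
  interleave-weight u v = trans (positions u v) (sym (trans
    (cong₂ (λ r s → if does (∣ r ⊝ s ∣ ℕ.≟ 1) then 2ℚ else 0ℚ) (toℕ-interleave u) (toℕ-interleave v))
    (path-weight 2ℚ ∣ pathPosition u ⊝ pathPosition v ∣)))
    where
    nonadjacent : ∀ i j → 0ℚ ≡ 2ℚ * indicator₁ ∣ 2 ℕ.* i ⊝ 2 ℕ.* j ∣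
    nonadjacent i j = cong (2ℚ *_) (sym (trans (cong indicator₁ (∣even-even∣ i j)) (indicator₁-even ∣ i ⊝ j ∣)))
    positions : ∀ u v → weight (BipartitePath (adjacentᵀ {m}) adjacent) u v ≡
      2ℚ * indicator₁ ∣ pathPosition u ⊝ pathPosition v ∣
    positions (inj₁ i) (inj₂ k) = cong (2ℚ *_) (adjacent≡indicator₁ k i)
    positions (inj₂ k) (inj₁ i) = cong (2ℚ *_)
      (trans (adjacent≡indicator₁ k i) (cong indicator₁ (ℕ.∣-∣-comm (evenPosition i) (oddPosition k))))
    positions (inj₁ i) (inj₁ j) = nonadjacent (toℕ i) (toℕ j)
    positions (inj₂ i) (inj₂ j) = nonadjacent (toℕ i) (toℕ j)

BipartitePath≈Path : ∀ m → BipartitePath (adjacentᵀ {m}) adjacent ≈ Path 2ℚ (pathLength m)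
BipartitePath≈Path m = relabel (⊎-finite (Fin-finite (suc m)) (Fin-finite m)) interleave↔ interleave-weight

-- Change of sign along the path, and the block of size two

sign : ℕ → ℚ
sign zero    = 1ℚ
sign (suc r) = - sign r

sign-square : ∀ r → sign r * sign r ≡ 1ℚ
sign-square zero    = refl
sign-square (suc r) = trans (solve 1 (λ a → (:- a) :* (:- a) := a :* a) refl (sign r)) (sign-square r)

sign-adjacent : ∀ r s → ∣ r ⊝ s ∣ ≡ 1 → sign s ≡ - sign r
sign-adjacent zero          (suc zero)    eq = refl
sign-adjacent (suc zero)    zero          eq = refl
sign-adjacent (suc r)       (suc s)       eq = cong -_ (sign-adjacent r s eq)

Path≈Path-neg : ∀ q p → Path q p ≈ Path (- q) p
Path≈Path-neg q p = record
  { finiteˡ = Fin-finite p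
  ; finiteʳ = Fin-finite p
  ; bijection = ↔-refl
  ; map = alternate
  ; isIso = record
    { linear = λ i → *-linear (sign (toℕ i)) (eval-linear i)
    ; injective = λ {f} eq i → trans (sym (involutive f i)) (trans (cong (sign (toℕ i) *_) (eq i)) (ℚ.*-zeroʳ (sign (toℕ i))))
    ; surjective = λ g → alternate g , involutive g
    }
  ; commutes = λ f i → trans (sum-cong-≗ (entry f i))
      (homogeneous sum-linear (sign (toℕ i)) (λ j → weight (Path q p) i j * f j))
  }
  where
  alternate : Fun (Fin p) → Fun (Fin p)
  alternate f i = sign (toℕ i) * f i
  involutive : ∀ f i → alternate (alternate f) i ≡ f i
  involutive f i = trans (sym (ℚ.*-assoc (sign (toℕ i)) (sign (toℕ i)) (f i)))
    (trans (cong (_* f i) (sign-square (toℕ i))) (ℚ.*-identityˡ (f i)))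
  entry : ∀ f i j → weight (Path (- q) p) i j * alternate f j ≡ sign (toℕ i) * (weight (Path q p) i j * f j)
  entry f i j = byCases (∣ toℕ i ⊝ toℕ j ∣ ℕ.≟ 1)
    where
    -- Both weights are governed by the same test; with the decision as an argument, one case split
    -- reduces both.
    byCases : (adj? : Dec (∣ toℕ i ⊝ toℕ j ∣ ≡ 1)) →
      (if does adj? then - q else 0ℚ) * alternate f j ≡ sign (toℕ i) * ((if does adj? then q else 0ℚ) * f j)
    byCases (no _)   = solve 3 (λ s t a → con 0ℚ :* (s :* a) := t :* (con 0ℚ :* a)) refl (sign (toℕ j)) (sign (toℕ i)) (f j)
    byCases (yes eq) = trans (cong (λ s → (- q) * (s * f j)) (sign-adjacent (toℕ i) (toℕ j) eq))
      (solve 3 (λ q s a → (:- q) :* ((:- s) :* a) := s :* (q :* a)) refl q (sign (toℕ i)) (f j))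

Loop : ℚ → Graph
Loop c .Vertex     = ⊤
Loop c .weight _ _ = c

Swap≈Loops : ∀ c → Swap c ≈ Loop c ⊍ Loop (- c)
Swap≈Loops c = record
  { finiteˡ = ⊎-finite ⊤-finite ⊤-finite
  ; finiteʳ = ⊎-finite ⊤-finite ⊤-finite
  ; bijection = ↔-refl
  ; map = T
  ; isIso = record
    { linear = λ { (inj₁ tt) → +-linear (eval-linear (inj₁ tt)) (eval-linear (inj₂ tt))
                 ; (inj₂ tt) → +-linear (eval-linear (inj₁ tt)) (-‿linear (eval-linear (inj₂ tt))) }
    ; injective = λ {f} p → let f₁≡0 , f₂≡0 = half-cancel (p (inj₁ tt)) (p (inj₂ tt))
                            in λ { (inj₁ tt) → f₁≡0 ; (inj₂ tt) → f₂≡0 }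
    ; surjective = λ g →
        [ const (½ * (g (inj₁ tt) + g (inj₂ tt))) , const (½ * (g (inj₁ tt) - g (inj₂ tt))) ]′ ,
        λ { (inj₁ tt) → solve 2 (λ a b → con ½ :* (a :+ b) :+ con ½ :* (a :- b) := a) refl (g (inj₁ tt)) (g (inj₂ tt))
          ; (inj₂ tt) → solve 2 (λ a b → con ½ :* (a :+ b) :- con ½ :* (a :- b) := b) refl (g (inj₁ tt)) (g (inj₂ tt)) }
    }
  ; commutes = λ f →
    λ { (inj₁ tt) → trans (expand (weight (Loop c ⊍ Loop (- c))) (T f) (inj₁ tt)) (trans
          (solve 3 (λ c a b → c :* (a :+ b) :+ con 0ℚ :* (a :- b) := (con 0ℚ :* a :+ c :* b) :+ (c :* a :+ con 0ℚ :* b))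
            refl c (f (inj₁ tt)) (f (inj₂ tt)))
          (sym (cong₂ _+_ (expand (weight (Swap c)) f (inj₁ tt)) (expand (weight (Swap c)) f (inj₂ tt)))))
      ; (inj₂ tt) → trans (expand (weight (Loop c ⊍ Loop (- c))) (T f) (inj₂ tt)) (trans
          (solve 3 (λ c a b → con 0ℚ :* (a :+ b) :+ (:- c) :* (a :- b) := (con 0ℚ :* a :+ c :* b) :- (c :* a :+ con 0ℚ :* b))
            refl c (f (inj₁ tt)) (f (inj₂ tt)))
          (sym (cong₂ _-_ (expand (weight (Swap c)) f (inj₁ tt)) (expand (weight (Swap c)) f (inj₂ tt))))) }
  }
  where
  T : Fun (⊤ ⊎ ⊤) → Fun (⊤ ⊎ ⊤)
  T f (inj₁ tt) = f (inj₁ tt) + f (inj₂ tt)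
  T f (inj₂ tt) = f (inj₁ tt) - f (inj₂ tt)
  expand : ∀ (w : ⊤ ⊎ ⊤ → ⊤ ⊎ ⊤ → ℚ) f u → apply (⊎-finite ⊤-finite ⊤-finite) w f u ≡
    w u (inj₁ tt) * f (inj₁ tt) + w u (inj₂ tt) * f (inj₂ tt)
  expand w f u = trans (∑-⊎ ⊤-finite ⊤-finite (λ v → w u v * f v))
    (cong₂ _+_ (∑-⊤ (λ v → w u (inj₁ v) * f (inj₁ v))) (∑-⊤ (λ v → w u (inj₂ v) * f (inj₂ v))))

-- Splitting the loop off a looped path

predecessor : (ℕ → ℚ) → ℕ → ℚ
predecessor h zero    = 0ℚ
predecessor h (suc r) = h r

-- The second term supplies `h p`, the right neighbour that the last point of the path lacks.
-- Nothing is supplied on the left, where `predecessor` is 0.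
neighbourSum : ∀ (h : ℕ → ℚ) {p} (j : Fin p) →
  sum {p} (λ i → h (toℕ i) * indicator₁ ∣ toℕ i ⊝ toℕ j ∣) + h p * (if does (suc (toℕ j) ℕ.≟ p) then 1ℚ else 0ℚ)
    ≡ h (suc (toℕ j)) + predecessor h (toℕ j)
neighbourSum h {suc zero} zero =
  solve 2 (λ a b → (a :* con 0ℚ :+ con 0ℚ) :+ b :* con 1ℚ := b :+ con 0ℚ) refl (h 0) (h 1)
neighbourSum h {suc (suc p)} zero = trans
  (cong (λ s → (h 0 * 0ℚ + (h 1 * 1ℚ + s)) + h (suc (suc p)) * 0ℚ) (ℓ-zero (sum-linear {p}) (λ i → ℚ.*-zeroʳ (h (suc (suc (toℕ i)))))))
  (solve 3 (λ a b c → (a :* con 0ℚ :+ (b :* con 1ℚ :+ con 0ℚ)) :+ c :* con 0ℚ := b :+ con 0ℚ) refl (h 0) (h 1) (h (suc (suc p))))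
neighbourSum h {suc p} (suc j) = trans (ℚ.+-assoc (h 0 * indicator₁ (suc (toℕ j))) _ _) (trans
  (cong (h 0 * indicator₁ (suc (toℕ j)) +_) (neighbourSum (h ∘ suc) j)) (first (toℕ j)))
  where
  first : ∀ r → h 0 * indicator₁ (suc r) + (h (suc (suc r)) + predecessor (h ∘ suc) r) ≡ h (suc (suc r)) + h r
  first zero    = solve 2 (λ a b → a :* con 1ℚ :+ (b :+ con 0ℚ) := b :+ a) refl (h 0) (h 2)
  first (suc r) = solve 3 (λ a b c → a :* con 0ℚ :+ (b :+ c) := b :+ c) refl (h 0) (h (suc (suc (suc r)))) (h (suc r))

-- (1, 2, …, p, p + 1) is a left eigenvector of the looped path.  The arc from
-- the extra vertex supplies the term that is missing at the end of the path.

leftEigenvector : ∀ q {p} (j : Fin p) →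
  sum {p} (λ i → natural (suc (toℕ i)) * weight (Path q p) i j) +
    natural (suc p) * (if does (suc (toℕ j) ℕ.≟ p) then q else 0ℚ)
  ≡ 2ℚ * q * natural (suc (toℕ j))
leftEigenvector q {p} j = begin
  sum {p} (λ i → h (toℕ i) * weight (Path q p) i j) + h p * (if b then q else 0ℚ)
    ≡⟨ cong₂ _+_ (sum-cong-≗ summand) (scale b) ⟩
  sum {p} (λ i → q * a i) + q * (h p * (if b then 1ℚ else 0ℚ))
    ≡⟨ cong (_+ q * (h p * (if b then 1ℚ else 0ℚ))) (homogeneous sum-linear q a) ⟩
  q * sum a + q * (h p * (if b then 1ℚ else 0ℚ))
    ≡⟨ ℚ.*-distribˡ-+ q (sum a) (h p * (if b then 1ℚ else 0ℚ)) ⟨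
  q * (sum a + h p * (if b then 1ℚ else 0ℚ))
    ≡⟨ cong (q *_) (neighbourSum h j) ⟩
  q * (h (suc (toℕ j)) + predecessor h (toℕ j))
    ≡⟨ cong (λ r → q * (h (suc (toℕ j)) + r)) (predecessor-natural (toℕ j)) ⟩
  q * ((1ℚ + (1ℚ + natural (toℕ j))) + natural (toℕ j))
    ≡⟨ solve 2 (λ q x → q :* ((con 1ℚ :+ (con 1ℚ :+ x)) :+ x) := con 2ℚ :* q :* (con 1ℚ :+ x)) refl q (natural (toℕ j)) ⟩
  2ℚ * q * natural (suc (toℕ j)) ∎
  where
  h : ℕ → ℚ
  h = natural ∘ suc
  b = does (suc (toℕ j) ℕ.≟ p)
  a : Fun (Fin p)
  a i = h (toℕ i) * indicator₁ ∣ toℕ i ⊝ toℕ j ∣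
  summand : ∀ i → h (toℕ i) * weight (Path q p) i j ≡ q * a i
  summand i = trans (cong (h (toℕ i) *_) (path-weight q ∣ toℕ i ⊝ toℕ j ∣))
    (solve 3 (λ x q y → x :* (q :* y) := q :* (x :* y)) refl (h (toℕ i)) q (indicator₁ ∣ toℕ i ⊝ toℕ j ∣))
  scale : ∀ b → h p * (if b then q else 0ℚ) ≡ q * (h p * (if b then 1ℚ else 0ℚ))
  scale true  = solve 2 (λ x q → x :* q := q :* (x :* con 1ℚ)) refl (h p) q
  scale false = solve 2 (λ x q → x :* con 0ℚ := q :* (x :* con 0ℚ)) refl (h p) q
  -- The progression 1, 2, ... continues to the left with 0, so the missing left neighbour does no
  -- harm and the neighbours of each entry average to it.
  predecessor-natural : ∀ r → predecessor h r ≡ natural r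
  predecessor-natural zero    = refl
  predecessor-natural (suc r) = refl

-- No arc leads from the path to the extra vertex, so the path coordinates already form a block.
-- Replacing the last coordinate by `μ`, the pairing with the left eigenvector, removes the
-- coupling; its entry `N` at the extra vertex is invertible, and the loop weight agrees with the
-- eigenvalue 2q.
LoopedPath≈Path⊍Loop : ∀ q p → LoopedPath q (2ℚ * q) (suc p) ≈ Path q p ⊍ Loop (2ℚ * q)
LoopedPath≈Path⊍Loop q p = record
  { finiteˡ = FM
  ; finiteʳ = ⊎-finite F ⊤-finite
  ; bijection = Maybe↔⊎⊤
  ; map = T
  ; isIso = record
    { linear = λ { (inj₁ j) → eval-linear (just j) ; (inj₂ tt) → μ-linear }
    ; injective = λ {f} eq → λ
      { (just j) → eq (inj₁ j)
      ; nothing → begin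
          f nothing                      ≡⟨ ℚ.*-identityˡ (f nothing) ⟨
          1ℚ * f nothing                 ≡⟨ cong (_* f nothing) N*r≡1 ⟨
          N * r * f nothing              ≡⟨ solve 3 (λ n r a → n :* r :* a := r :* (con 0ℚ :+ n :* a)) refl N r (f nothing) ⟩
          r * (0ℚ + N * f nothing)       ≡⟨ cong (λ s → r * (s + N * f nothing)) (ℓ-zero (pathSum-linear) (eq ∘ inj₁)) ⟨
          r * μ f                        ≡⟨ cong (r *_) (eq (inj₂ tt)) ⟩
          r * 0ℚ                         ≡⟨ ℚ.*-zeroʳ r ⟩
          0ℚ                             ∎ }
    ; surjective = λ g → preimage g , λ
      { (inj₁ j) → refl
      ; (inj₂ tt) → let s = pathSum (g ∘ inj₁) ; t = g (inj₂ tt) in begin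
          s + N * (r * (t - s))     ≡⟨ solve 4 (λ s n r t → s :+ n :* (r :* (t :- s)) := s :+ (n :* r) :* (t :- s)) refl s N r t ⟩
          s + (N * r) * (t - s)     ≡⟨ cong (λ u → s + u * (t - s)) N*r≡1 ⟩
          s + 1ℚ * (t - s)          ≡⟨ solve 2 (λ s t → s :+ con 1ℚ :* (t :- s) := t) refl s t ⟩
          t                         ∎ }
    }
  ; commutes = λ f → λ
    { (inj₁ j) → trans (operator-⊍ˡ (Path q p) (Loop c) F ⊤-finite (T f) j) (sym (operator-just f j))
    ; (inj₂ tt) → trans (operator-⊍ʳ (Path q p) (Loop c) F ⊤-finite (T f) tt)
        (trans (∑-⊤ (λ _ → c * μ f)) (sym (μ-eigen f))) }
  }
  where
  c = 2ℚ * q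
  G = LoopedPath q c (suc p)
  F = Fin-finite p
  FM = Maybe-finite F
  N = natural (suc p)
  r = proj₁ (natural-invertible p)
  N*r≡1 = proj₂ (natural-invertible p)

  Maybe↔⊎⊤ : Maybe (Fin p) ↔ (Fin p ⊎ ⊤)
  Maybe↔⊎⊤ = mk↔ₛ′ (λ { (just j) → inj₁ j ; nothing → inj₂ tt }) (λ { (inj₁ j) → just j ; (inj₂ tt) → nothing })
    (λ { (inj₁ _) → refl ; (inj₂ tt) → refl }) (λ { (just _) → refl ; nothing → refl })

  pathSum : Fun (Fin p) → ℚ
  pathSum g = sum (λ j → natural (suc (toℕ j)) * g j)

  pathSum-linear : LinearForm pathSum
  pathSum-linear = ∘-linear sum-linear (λ j → *-linear (natural (suc (toℕ j))) (eval-linear j))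

  μ : Fun (Maybe (Fin p)) → ℚ
  μ f = pathSum (f ∘ just) + N * f nothing

  μ-linear : LinearForm μ
  μ-linear = +-linear (∘-linear pathSum-linear (restrict-linear just)) (*-linear N (eval-linear nothing))

  T : Fun (Maybe (Fin p)) → Fun (Fin p ⊎ ⊤)
  T f (inj₁ j)  = f (just j)
  T f (inj₂ tt) = μ f

  preimage : Fun (Fin p ⊎ ⊤) → Fun (Maybe (Fin p))
  preimage g (just j) = g (inj₁ j)
  preimage g nothing  = r * (g (inj₂ tt) - pathSum (g ∘ inj₁))

  operator-just : ∀ f j → operator G FM f (just j) ≡ operator (Path q p) F (f ∘ just) j
  operator-just f j = trans (∑-Maybe F (λ v → weight G (just j) v * f v))
    (solve 2 (λ a b → con 0ℚ :* a :+ b := b) refl (f nothing) _)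

  lastWeight : Fin p → ℚ
  lastWeight j = if does (suc (toℕ j) ℕ.≟ p) then q else 0ℚ

  operator-nothing : ∀ f → operator G FM f nothing ≡ c * f nothing + sum (λ j → lastWeight j * f (just j))
  operator-nothing f = ∑-Maybe F (λ v → weight G nothing v * f v)

  μ-eigen : ∀ f → μ (operator G FM f) ≡ c * μ f
  μ-eigen f = begin
    pathSum (operator G FM f ∘ just) + N * operator G FM f nothing
      ≡⟨ cong₂ _+_ (ℓ-cong pathSum-linear (operator-just f)) (cong (N *_) (operator-nothing f)) ⟩
    pathSum (operator (Path q p) F g) + N * (c * f nothing + l)
      ≡⟨ cong (_+ N * (c * f nothing + l)) exchange ⟩
    sum (λ j → A j * g j) + N * (c * f nothing + l)
      ≡⟨ solve 5 (λ a n c x l → a :+ n :* (c :* x :+ l) := (a :+ n :* l) :+ c :* (n :* x)) refl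
           (sum (λ j → A j * g j)) N c (f nothing) l ⟩
    (sum (λ j → A j * g j) + N * l) + c * (N * f nothing)
      ≡⟨ cong (_+ c * (N * f nothing)) combine ⟩
    c * pathSum g + c * (N * f nothing)
      ≡⟨ ℚ.*-distribˡ-+ c (pathSum g) (N * f nothing) ⟨
    c * μ f ∎
    where
    g = f ∘ just
    l = sum (λ j → lastWeight j * g j)
    A : Fun (Fin p)
    A j = pathSum (λ i → weight (Path q p) i j)
    exchange : pathSum (operator (Path q p) F g) ≡ sum (λ j → A j * g j)
    exchange = begin
      pathSum (λ i → sum (λ j → weight (Path q p) i j * g j))
        ≡⟨ linear-exchange pathSum-linear F sum-linear (λ i j → weight (Path q p) i j * g j) ⟩
      sum (λ j → pathSum (λ i → weight (Path q p) i j * g j))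
        ≡⟨ sum-cong-≗ (λ j → trans (ℓ-cong pathSum-linear (λ i → ℚ.*-comm (weight (Path q p) i j) (g j)))
             (trans (homogeneous pathSum-linear (g j) (λ i → weight (Path q p) i j)) (ℚ.*-comm (g j) (A j)))) ⟩
      sum (λ j → A j * g j) ∎
    combine : sum (λ j → A j * g j) + N * l ≡ c * pathSum g
    combine = begin
      sum (λ j → A j * g j) + N * l
        ≡⟨ cong (sum (λ j → A j * g j) +_) (homogeneous sum-linear N (λ j → lastWeight j * g j)) ⟨
      sum (λ j → A j * g j) + sum (λ j → N * (lastWeight j * g j))
        ≡⟨ additive sum-linear (λ j → A j * g j) (λ j → N * (lastWeight j * g j)) ⟨
      sum (λ j → A j * g j + N * (lastWeight j * g j))
        ≡⟨ sum-cong-≗ (λ j → trans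
             (solve 4 (λ a n w g → a :* g :+ n :* (w :* g) := (a :+ n :* w) :* g) refl (A j) N (lastWeight j) (g j))
             (trans (cong (_* g j) (leftEigenvector q j)) (ℚ.*-assoc c (natural (suc (toℕ j))) (g j)))) ⟩
      sum (λ j → c * (natural (suc (toℕ j)) * g j))
        ≡⟨ homogeneous sum-linear c (λ j → natural (suc (toℕ j)) * g j) ⟩
      c * pathSum g ∎

-- Regrouping the summands

module _ {G H K L : Graph} (FG : Finite (Vertex G)) (FH : Finite (Vertex H))
         (FK : Finite (Vertex K)) (FL : Finite (Vertex L)) where

  ⊍-interchange : G ⊍ H ⊍ K ⊍ L ≈ (G ⊍ K) ⊍ (H ⊍ L)
  ⊍-interchange = relabel (⊎-finite FG (⊎-finite FH (⊎-finite FK FL))) β weight≡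
    where
    β : Vertex (G ⊍ H ⊍ K ⊍ L) ↔ Vertex ((G ⊍ K) ⊍ (H ⊍ L))
    β = mk↔ₛ′
      (λ { (inj₁ g) → inj₁ (inj₁ g) ; (inj₂ (inj₁ h)) → inj₂ (inj₁ h)
         ; (inj₂ (inj₂ (inj₁ k))) → inj₁ (inj₂ k) ; (inj₂ (inj₂ (inj₂ l))) → inj₂ (inj₂ l) })
      (λ { (inj₁ (inj₁ g)) → inj₁ g ; (inj₂ (inj₁ h)) → inj₂ (inj₁ h)
         ; (inj₁ (inj₂ k)) → inj₂ (inj₂ (inj₁ k)) ; (inj₂ (inj₂ l)) → inj₂ (inj₂ (inj₂ l)) })
      (λ { (inj₁ (inj₁ _)) → refl ; (inj₂ (inj₁ _)) → refl ; (inj₁ (inj₂ _)) → refl ; (inj₂ (inj₂ _)) → refl })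
      (λ { (inj₁ _) → refl ; (inj₂ (inj₁ _)) → refl ; (inj₂ (inj₂ (inj₁ _))) → refl ; (inj₂ (inj₂ (inj₂ _))) → refl })
    weight≡ : ∀ u v → weight (G ⊍ H ⊍ K ⊍ L) u v ≡ weight ((G ⊍ K) ⊍ (H ⊍ L)) (to β u) (to β v)
    weight≡ (inj₁ _)               (inj₁ _)               = refl
    weight≡ (inj₁ _)               (inj₂ (inj₁ _))        = refl
    weight≡ (inj₁ _)               (inj₂ (inj₂ (inj₁ _))) = refl
    weight≡ (inj₁ _)               (inj₂ (inj₂ (inj₂ _))) = refl
    weight≡ (inj₂ (inj₁ _))        (inj₁ _)               = refl
    weight≡ (inj₂ (inj₁ _))        (inj₂ (inj₁ _))        = refl
    weight≡ (inj₂ (inj₁ _))        (inj₂ (inj₂ (inj₁ _))) = refl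
    weight≡ (inj₂ (inj₁ _))        (inj₂ (inj₂ (inj₂ _))) = refl
    weight≡ (inj₂ (inj₂ (inj₁ _))) (inj₁ _)               = refl
    weight≡ (inj₂ (inj₂ (inj₁ _))) (inj₂ (inj₁ _))        = refl
    weight≡ (inj₂ (inj₂ (inj₁ _))) (inj₂ (inj₂ (inj₁ _))) = refl
    weight≡ (inj₂ (inj₂ (inj₁ _))) (inj₂ (inj₂ (inj₂ _))) = refl
    weight≡ (inj₂ (inj₂ (inj₂ _))) (inj₁ _)               = refl
    weight≡ (inj₂ (inj₂ (inj₂ _))) (inj₂ (inj₁ _))        = refl
    weight≡ (inj₂ (inj₂ (inj₂ _))) (inj₂ (inj₂ (inj₁ _))) = refl
    weight≡ (inj₂ (inj₂ (inj₂ _))) (inj₂ (inj₂ (inj₂ _))) = refl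

-- Both paths have weight 2. One is changed to weight -2, so that each can be paired with the
-- eigenvalue of `Swap 4ℚ` that is twice its weight.
paths⊍Swap≈S⊍S′ : ∀ m →
  BipartitePath (adjacentᵀ {m}) adjacent ⊍ BipartitePath (adjacentᵀ {m}) adjacent ⊍ Swap 4ℚ
    ≈ S (2 ℕ.* suc m) ⊍ S′ (2 ℕ.* suc m)
paths⊍Swap≈S⊍S′ m = ≈-trans
  (⊍-cong (BipartitePath≈Path m)
    (⊍-cong (≈-trans (BipartitePath≈Path m) (Path≈Path-neg 2ℚ (pathLength m))) (Swap≈Loops 4ℚ)))
  (≈-trans (⊍-interchange F F ⊤-finite ⊤-finite)
    -- The loop weights `2ℚ * 2ℚ` and `2ℚ * (- 2ℚ)` compute to 4 and -4.
    (≈-sym (⊍-cong (LoopedPath≈Path⊍Loop 2ℚ (pathLength m)) (LoopedPath≈Path⊍Loop (- 2ℚ) (pathLength m)))))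
  where F = Fin-finite (pathLength m)

-- In the block of differences in both coordinates the positions run over 0, ..., 2m after the
-- shift, and the zero boundary values leave no row doubled. By `Board≈AD` this is again a diamond,
-- of order one less.
FoldedAD≈AD⊍S⊍S′ : ∀ m → FoldedAD (suc m) ≈ AD m ⊍ S (2 ℕ.* suc m) ⊍ S′ (2 ℕ.* suc m)
FoldedAD≈AD⊍S⊍S′ m =
  ≈-trans (≈-sym (reflectingBoard≈FoldedAD m))
  (≈-trans (reflectingBoard≈augmentedBoard m)
  (≈-trans (augmentedBoard≈Parts adjacentᵀ adjacent (Fin-finite (suc m)) (Fin-finite m))
  (⊍-cong (Board≈AD m) (paths⊍Swap≈S⊍S′ m))))

theorem6p1 : ∀ (n : ℕ) → 1 ≤ n →
    Similar (AP n) (AD (n ∸ 1) ⊍ AD (n ∸ 1) ⊍ S (2 ℕ.* n) ⊍ S′ (2 ℕ.* n))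
theorem6p1 (suc m) _ = ≈⇒Similar
  (≈-trans (Folding.AP≈AD⊍FoldedAD m (ADVertex-finite m) (ADVertex-finite (suc m)))
           (⊍-cong (≈-refl (ADVertex-finite m)) (FoldedAD≈AD⊍S⊍S′ m)))
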